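{- Let $q$ be a power of $3$ and let $f$ be a binary quartic form over $\mathbb{F}_q$ with $\Delta(f)\neq0$ and $\jmath(f)=r\ne0$, normalized so that the coefficient of $X^2Y^2$ is $1$. Let $\zeta_f$ be the number of $(x:y)\in PG(1,q)$ such that $f(x,y)$ is a nonzero square in $\mathbb{F}_q$. Then $\zeta_f=\frac{\#\mathcal{E}_r(\mathbb{F}_q)-i}{2}$ if $f\in\mathcal{F}_i$ for $i\in\{1,2,4\}$, and $\zeta_f=\frac{\#\mathcal{E}_r(\mathbb{F}_q)}{2}$ if $f\in\mathcal{F}_2'\cup\mathcal{F}_4'$.
   Context: For $f=z_0X^4+z_1X^3Y+z_2X^2Y^2+z_3XY^3+z_4Y^4$: $\Delta(f)=(z_0z_4-z_1z_3)^3+(z_0z_4-z_1z_3)^2z_2^2-z_2^3(z_0z_3^2+z_4z_1^2-z_0z_2z_4)$ and $\jmath(f)=z_2^6/\Delta(f)$. Types by factorization over $\mathbb{F}_q$: $\mathcal{F}_4$ four linear; $\mathcal{F}_2$ two linear and an irreducible quadratic; $\mathcal{F}_1$ one linear and an irreducible cubic; $\mathcal{F}_4'$ two irreducible quadratics; $\mathcal{F}_2'$ irreducible. For $r\in\mathbb{F}_q^\times$, $\mathcal{E}_r$ is the elliptic curve $S^2=T^3+T^2-r^{ -1}$ in $\mathbb{P}^2$, and $\#\mathcal{E}_r(\mathbb{F}_q)$ is its number of $\mathbb{F}_q$-rational points, including the point at infinity. -}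

module Defs where

open import Level using (Level; suc; _⊔_)
open import Data.Nat as ℕ using (ℕ)
open import Data.List using (List; length; filter; _++_; map; concatMap)
open import Data.List.Membership.Propositional using (_∈_)
open import Data.List.Relation.Unary.Unique.Propositional using (Unique)
open import Data.List.Relation.Unary.Any using (Any; any?)
open import Data.Product using (Σ; ∃; _×_; _,_; proj₁; proj₂)
open import Relation.Nullary using (¬_; Dec; yes; no)
open import Relation.Binary.PropositionalEquality using (_≡_; _≢_; refl; subst)
open import Relation.Binary.Definitions using (DecidableEquality)
open import Algebra.Structures using (IsCommutativeRing)

record FiniteField (c : Level) : Set (suc c) where
  infixl 7 _*_
  infixl 6 _+_ _-_
  field
    Carrier  : Set c
    _+_ _*_  : Carrier → Carrier → Carrier
    -_       : Carrier → Carrier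
    0# 1#    : Carrier
    _⁻¹      : Carrier → Carrier
    isCommutativeRing : IsCommutativeRing _≡_ _+_ _*_ -_ 0# 1#
    0≢1      : 0# ≢ 1#
    ⁻¹-inverse : ∀ x → x ≢ 0# → x * (x ⁻¹) ≡ 1#
    _≟_      : DecidableEquality Carrier
    elements : List Carrier
    complete : ∀ x → x ∈ elements
    unique   : Unique elements

  _-_ : Carrier → Carrier → Carrier
  x - y = x + (- y)

  size : ℕ
  size = length elements

  _·1 : ℕ → Carrier
  ℕ.zero ·1 = 0#
  ℕ.suc n ·1 = 1# + (n ·1)

  _^_ : Carrier → ℕ → Carrier
  x ^ ℕ.zero = 1#
  x ^ ℕ.suc n = x * (x ^ n)

-- q is a power of 3  ⇔  the finite field has characteristic 3
HasChar3 : ∀ {c} → FiniteField c → Set c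
HasChar3 F = (3 ·1) ≡ 0#
  where open FiniteField F

module _ {c} (F : FiniteField c) where
  open FiniteField F

  decΣ : {P : Carrier → Set c} → (∀ x → Dec (P x)) → Dec (Σ Carrier P)
  decΣ {P} P? with any? P? elements
  ... | yes a = yes (find a)
    where
      find : ∀ {xs} → Any P xs → Σ Carrier P
      find (Any.here p)  = _ , p
      find (Any.there a) = find a
  ... | no ¬a = no λ { (x , p) → ¬a (lift (complete x) p) }
    where
      lift : ∀ {x xs} → x ∈ xs → P x → Any P xs
      lift (Any.here refl) p = Any.here p
      lift (Any.there m)   p = Any.there (lift m p)

  count : {A : Set c} {P : A → Set c} → (∀ x → Dec (P x)) → List A → ℕ
  count P? xs = length (filter P? xs)

  record Quartic : Set c where
    constructor quartic
    field z0 z1 z2 z3 z4 : Carrier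

  open Quartic public

  eval : Quartic → Carrier → Carrier → Carrier
  eval f x y = z0 f * x ^ 4 + z1 f * x ^ 3 * y + z2 f * x ^ 2 * y ^ 2
             + z3 f * x * y ^ 3 + z4 f * y ^ 4

  Δ : Quartic → Carrier
  Δ (quartic a0 a1 a2 a3 a4) =
    (a0 * a4 - a1 * a3) ^ 3 + (a0 * a4 - a1 * a3) ^ 2 * a2 ^ 2
    - a2 ^ 3 * (a0 * a3 ^ 2 + a4 * a1 ^ 2 - a0 * a2 * a4)

  ȷ : Quartic → Carrier
  ȷ f = z2 f ^ 6 * (Δ f ⁻¹)

  -- a X + b Y
  record Lin : Set c where
    constructor lin
    field l0 l1 : Carrier

  -- a X^2 + b XY + c Y^2
  record Quad : Set c where
    constructor quad
    field q0 q1 q2 : Carrier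

  -- a X^3 + b X^2 Y + c X Y^2 + d Y^3
  record Cub : Set c where
    constructor cub
    field c0 c1 c2 c3 : Carrier

  linLin : Lin → Lin → Quad
  linLin (lin a b) (lin c d) = quad (a * c) (a * d + b * c) (b * d)

  linQuad : Lin → Quad → Cub
  linQuad (lin a b) (quad c d e) =
    cub (a * c) (a * d + b * c) (a * e + b * d) (b * e)

  linCub : Lin → Cub → Quartic
  linCub (lin a b) (cub c d e g) =
    quartic (a * c) (a * d + b * c) (a * e + b * d) (a * g + b * e) (b * g)

  quadQuad : Quad → Quad → Quartic
  quadQuad (quad a b c) (quad d e g) =
    quartic (a * d) (a * e + b * d) (a * g + b * e + c * d) (b * g + c * e) (c * g)

  IrredQuad : Quad → Set c
  IrredQuad Q = ¬ (Σ Lin λ L → Σ Lin λ M → linLin L M ≡ Q)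

  IrredCub : Cub → Set c
  IrredCub C = ¬ (Σ Lin λ L → Σ Quad λ Q → linQuad L Q ≡ C)

  IrredQuartic : Quartic → Set c
  IrredQuartic f = ¬ (Σ Lin λ L → Σ Cub λ C → linCub L C ≡ f)
                 × ¬ (Σ Quad λ Q → Σ Quad λ R → quadQuad Q R ≡ f)

  IsF4 : Quartic → Set c
  IsF4 f = Σ Lin λ L1 → Σ Lin λ L2 → Σ Lin λ L3 → Σ Lin λ L4 →
           quadQuad (linLin L1 L2) (linLin L3 L4) ≡ f
  IsF2 : Quartic → Set c
  IsF2 f = Σ Lin λ L1 → Σ Lin λ L2 → Σ Quad λ Q →
           IrredQuad Q × quadQuad (linLin L1 L2) Q ≡ f
  IsF1 : Quartic → Set c
  IsF1 f = Σ Lin λ L → Σ Cub λ C → IrredCub C × linCub L C ≡ f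
  IsF4' : Quartic → Set c
  IsF4' f = Σ Quad λ Q → Σ Quad λ R →
            IrredQuad Q × IrredQuad R × quadQuad Q R ≡ f
  IsF2' : Quartic → Set c
  IsF2' f = IrredQuartic f

  IsSquare : Carrier → Set c
  IsSquare y = Σ Carrier λ s → s * s ≡ y

  NonzeroSquare : Carrier → Set c
  NonzeroSquare y = y ≢ 0# × IsSquare y

  nonzeroSquare? : ∀ y → Dec (NonzeroSquare y)
  nonzeroSquare? y with y ≟ 0# | decΣ (λ s → (s * s) ≟ y)
  ... | yes y≡0 | _     = no λ p → proj₁ p y≡0
  ... | no y≢0  | yes s = yes (y≢0 , s)
  ... | no y≢0  | no ¬s = no λ p → ¬s (proj₂ p)

  PG1 : List (Carrier × Carrier)
  PG1 = map (λ x → x , 1#) elements ++ ((1# , 0#) ∷ [])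
    where open Data.List using (_∷_; [])

  ζ : Quartic → ℕ
  ζ f = count (λ p → nonzeroSquare? (eval f (proj₁ p) (proj₂ p))) PG1

  PG2 : List (Carrier × Carrier × Carrier)
  PG2 = concatMap (λ s → map (λ t → s , t , 1#) elements) elements
     ++ map (λ s → s , 1# , 0#) elements
     ++ ((1# , 0# , 0#) ∷ [])
    where open Data.List using (_∷_; [])

  -- 𝓔_r : S^2 = T^3 + T^2 - r^{-1}, projectively  S^2 Z = T^3 + T^2 Z - r^{-1} Z^3
  OnE : Carrier → Carrier × Carrier × Carrier → Set c
  OnE r (s , t , z) = s ^ 2 * z ≡ t ^ 3 + t ^ 2 * z - (r ⁻¹) * z ^ 3

  #E : Carrier → ℕ
  #E r = count (λ p → onE? p) PG2
    where
      onE? : ∀ p → Dec (OnE r p)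
      onE? (s , t , z) = (s ^ 2 * z) ≟ (t ^ 3 + t ^ 2 * z - (r ⁻¹) * z ^ 3)

{-# OPTIONS --safe #-}
module Submission where

-- Let C be the curve s² = f(x, y), so that #C = 2ζ + #{zeros of f in PG(1,q)}; the types fix the
-- number of zeros, which are simple because Δ ≠ 0. The identity #C = #E is proved by moving a point
-- where f is a square to infinity (translations and X ↔ Y preserve z2, Δ and #C). If z0 = 0 the curve
-- is already a cubic. If z0 = a ≠ 0 and z1 = 0, the substitution s = u + x² makes a s² = f(x) quadratic
-- in x, and comparing with its discriminant gives
--   #{(x,s) : a s² = f(x)} + 1 = #{(u,v) : v² = cubic in u} ≤ 2q.
-- For a a square the cubic is E. The same bound shows that f has a square value: otherwise each of the
-- q fibres on the left would have two points.

open import Defs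
open import Level using (Level)
open import Algebra.Bundles using (CommutativeRing; RawRing)
open import Algebra.Solver.Ring.AlmostCommutativeRing
  using (_-Raw-AlmostCommutative⟶_; fromCommutativeRing)
import Algebra.Solver.Ring as RingSolver
import Algebra.Properties.Ring as RingProperties
open import Data.Nat using (ℕ; _≤_; z≤n; s≤s)
import Data.Nat as ℕ
import Data.Nat.Properties as ℕ
open import Algebra.Properties.CommutativeSemigroup ℕ.+-commutativeSemigroup using (interchange)
open import Data.Nat.ListAction using (sum)
open import Data.Nat.ListAction.Properties using (sum-++)
open import Data.List using (List; []; _∷_; _++_; map; concatMap; filter; length)
open import Data.List.Properties using (map-cong; map-++; map-∘)
open import Data.List.Membership.Propositional using (_∈_; _∉_)
open import Data.List.Relation.Unary.Any using (here; there)
import Data.List.Relation.Unary.All as All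
open import Data.List.Relation.Unary.AllPairs using (_∷_)
open import Data.List.Relation.Unary.Unique.Propositional using (Unique)
open import Data.Maybe using (Maybe; just; nothing)
open import Data.Product using (Σ; _×_; _,_; proj₁; proj₂)
open import Data.Sum using (_⊎_; inj₁; inj₂; [_,_]′)
open import Function using (_∘_)
open import Relation.Nullary using (¬_; Dec; yes; no; contradiction)
open import Relation.Unary using (Pred; Decidable)
open import Relation.Binary.Definitions using (DecidableEquality)
open import Relation.Binary.PropositionalEquality
  using (_≡_; _≢_; refl; sym; trans; cong; cong₂; subst; module ≡-Reasoning)

-- The obstacle is that s² = f has genus one but no evident rational point, and only such a point
-- relates it to a Weierstrass cubic. A square leading coefficient supplies one at infinity. The
-- term + 1 in the displayed equality is the entire margin by which a point is shown to exist. It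
-- comes from the single value u = -1/a at which the quadratic in x loses its leading coefficient:
-- there Δ ≠ 0 forces exactly one root fewer than the discriminant has square roots. Characteristic
-- 3 enters three times. The translation X → X + tY changes z2 by 3t z1 + 6t² z0 = 0, so the
-- normalization survives every move. It changes z1 by 4t z0 = t z0, so z1 can be removed. Finally,
-- z2 = 1 gives r⁻¹ = Δ, and the shift T = (multiple of the variable) + z0 z4 - z1 z3 brings both
-- cubics that occur to T³ + T² - Δ.

module FiniteSums where
  open import Data.Nat using (suc; _+_; _*_)
  open import Data.Nat.Properties using
    ( *-zeroʳ; *-distribˡ-+; +-identityʳ; +-mono-≤; +-monoˡ-≤; +-monoʳ-≤
    ; +-cancelˡ-≤; +-cancelʳ-≤; ≤-antisym; module ≤-Reasoning)

  private variable
    a p q : Level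
    A B : Set a
    P : Set p
    Q : Set q

  -- Indicators and finite sums over lists

  𝟙 : Dec P → ℕ
  𝟙 (yes _) = 1
  𝟙 (no _)  = 0

  𝟙-yes : (d : Dec P) → P → 𝟙 d ≡ 1
  𝟙-yes (yes _) _ = refl
  𝟙-yes (no ¬p) p = contradiction p ¬p

  𝟙-no : (d : Dec P) → ¬ P → 𝟙 d ≡ 0
  𝟙-no (yes p) ¬p = contradiction p ¬p
  𝟙-no (no _)  _  = refl

  𝟙-cong : (d : Dec P) (e : Dec Q) → (P → Q) → (Q → P) → 𝟙 d ≡ 𝟙 e
  𝟙-cong (yes p) e f g = sym (𝟙-yes e (f p))
  𝟙-cong (no ¬p) e f g = sym (𝟙-no e λ q → ¬p (g q))

  ∑ : List A → (A → ℕ) → ℕ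
  ∑ xs f = sum (map f xs)

  ∑-cong : {f g : A → ℕ} → (∀ x → f x ≡ g x) → ∀ xs → ∑ xs f ≡ ∑ xs g
  ∑-cong f≗g xs = cong sum (map-cong f≗g xs)

  ∑-zero : (xs : List A) → ∑ xs (λ _ → 0) ≡ 0
  ∑-zero []       = refl
  ∑-zero (_ ∷ xs) = ∑-zero xs

  ∑-one : (xs : List A) → ∑ xs (λ _ → 1) ≡ length xs
  ∑-one []       = refl
  ∑-one (_ ∷ xs) = cong suc (∑-one xs)

  ∑-+ : (f g : A → ℕ) → ∀ xs → ∑ xs (λ x → f x + g x) ≡ ∑ xs f + ∑ xs g
  ∑-+ f g []       = refl
  ∑-+ f g (x ∷ xs) = trans (cong (f x + g x +_) (∑-+ f g xs)) (interchange (f x) (g x) (∑ xs f) (∑ xs g))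

  ∑-*ˡ : ∀ n (f : A → ℕ) xs → ∑ xs (λ x → n * f x) ≡ n * ∑ xs f
  ∑-*ˡ n f []       = sym (*-zeroʳ n)
  ∑-*ˡ n f (x ∷ xs) = trans (cong (n * f x +_) (∑-*ˡ n f xs)) (sym (*-distribˡ-+ n (f x) _))

  ∑-swap : (h : A → B → ℕ) → ∀ xs ys →
    ∑ xs (λ x → ∑ ys (h x)) ≡ ∑ ys (λ y → ∑ xs (λ x → h x y))
  ∑-swap h []       ys = sym (∑-zero ys)
  ∑-swap h (x ∷ xs) ys =
    trans (cong (∑ ys (h x) +_) (∑-swap h xs ys)) (sym (∑-+ (h x) _ ys))

  ∑-++ : (f : A → ℕ) → ∀ xs ys → ∑ (xs ++ ys) f ≡ ∑ xs f + ∑ ys f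
  ∑-++ f xs ys = trans (cong sum (map-++ f xs ys)) (sum-++ (map f xs) (map f ys))

  ∑-map : (f : B → ℕ) (g : A → B) → ∀ xs → ∑ (map g xs) f ≡ ∑ xs (λ x → f (g x))
  ∑-map f g xs = cong sum (sym (map-∘ xs))

  ∑-concatMap : (f : B → ℕ) (g : A → List B) → ∀ xs →
    ∑ (concatMap g xs) f ≡ ∑ xs (λ x → ∑ (g x) f)
  ∑-concatMap f g []       = refl
  ∑-concatMap f g (x ∷ xs) =
    trans (∑-++ f (g x) (concatMap g xs)) (cong (∑ (g x) f +_) (∑-concatMap f g xs))

  length-filter : {P : Pred A p} (P? : Decidable P) → ∀ xs →
    length (filter P? xs) ≡ ∑ xs (λ x → 𝟙 (P? x))
  length-filter P? []       = refl
  length-filter P? (x ∷ xs) with P? x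
  ... | yes _ = cong suc (length-filter P? xs)
  ... | no  _ = length-filter P? xs

  ∑-mono-≤ : {f g : A → ℕ} → (∀ x → f x ≤ g x) → ∀ xs → ∑ xs f ≤ ∑ xs g
  ∑-mono-≤ f≤g []       = z≤n
  ∑-mono-≤ f≤g (x ∷ xs) = +-mono-≤ (f≤g x) (∑-mono-≤ f≤g xs)

  -- Termwise inequality and equal totals leave no slack: a gap at one entry would have to be repaid
  -- by the others, against `∑-mono-≤`. This turns an equality of averages into a pointwise one.
  ∑-squeeze : {f g : A → ℕ} → (∀ x → f x ≤ g x) → ∀ xs → ∑ xs f ≡ ∑ xs g →
    ∀ {x} → x ∈ xs → f x ≡ g x
  ∑-squeeze {f = f} {g} f≤g (x ∷ xs) eq (here refl) =
    ≤-antisym (f≤g x) (+-cancelʳ-≤ (∑ xs f) (g x) (f x) (begin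
      g x + ∑ xs f  ≤⟨ +-monoʳ-≤ (g x) (∑-mono-≤ f≤g xs) ⟩
      g x + ∑ xs g  ≡⟨ eq ⟨
      f x + ∑ xs f  ∎))
    where open ≤-Reasoning
  ∑-squeeze {f = f} {g} f≤g (x ∷ xs) eq (there i) =
    ∑-squeeze f≤g xs (≤-antisym (∑-mono-≤ f≤g xs) (+-cancelˡ-≤ (f x) (∑ xs g) (∑ xs f) (begin
      f x + ∑ xs g  ≤⟨ +-monoˡ-≤ (∑ xs g) (f≤g x) ⟩
      g x + ∑ xs g  ≡⟨ eq ⟨
      f x + ∑ xs f  ∎))) i
    where open ≤-Reasoning

  module _ (_≟_ : DecidableEquality A) where

    ∑-δ-∉ : (f : A → ℕ) → ∀ {a} xs → a ∉ xs → ∑ xs (λ x → 𝟙 (x ≟ a) * f x) ≡ 0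
    ∑-δ-∉ f         []       _    = refl
    ∑-δ-∉ f {a = a} (x ∷ xs) a∉xs
      rewrite 𝟙-no (x ≟ a) (λ x≡a → a∉xs (here (sym x≡a))) = ∑-δ-∉ f xs (λ a∈ → a∉xs (there a∈))

    ∑-δ : (f : A → ℕ) → ∀ {a xs} → Unique xs → a ∈ xs → ∑ xs (λ x → 𝟙 (x ≟ a) * f x) ≡ f a
    ∑-δ f {a} {_ ∷ xs} (a≉xs ∷ _) (here refl)
      rewrite 𝟙-yes (a ≟ a) refl | ∑-δ-∉ f xs (λ a∈ → All.lookup a≉xs a∈ refl)
      = trans (+-identityʳ _) (+-identityʳ _)
    ∑-δ f {a} {x ∷ xs} (x≉xs ∷ u) (there a∈)
      rewrite 𝟙-no (x ≟ a) (All.lookup x≉xs a∈) = ∑-δ f u a∈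

open FiniteSums

-- The coefficient ring of the ring solver. Normal forms are computed modulo 3, so identities that
-- depend on 3 = 0 come out by reflection.
data 𝔽₃ : Set where
  0₃ 1₃ 2₃ : 𝔽₃

rawRing₃ : RawRing _ _
rawRing₃ = record
  { Carrier = 𝔽₃ ; _≈_ = _≡_ ; _+_ = _+₃_ ; _*_ = _*₃_ ; -_ = -₃_ ; 0# = 0₃ ; 1# = 1₃ }
  where
  _+₃_ : 𝔽₃ → 𝔽₃ → 𝔽₃
  0₃ +₃ y  = y
  1₃ +₃ 0₃ = 1₃
  1₃ +₃ 1₃ = 2₃
  1₃ +₃ 2₃ = 0₃
  2₃ +₃ 0₃ = 2₃
  2₃ +₃ 1₃ = 0₃
  2₃ +₃ 2₃ = 1₃
  _*₃_ : 𝔽₃ → 𝔽₃ → 𝔽₃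
  0₃ *₃ y  = 0₃
  1₃ *₃ y  = y
  2₃ *₃ 0₃ = 0₃
  2₃ *₃ 1₃ = 2₃
  2₃ *₃ 2₃ = 1₃
  -₃_ : 𝔽₃ → 𝔽₃
  -₃ 0₃ = 0₃
  -₃ 1₃ = 2₃
  -₃ 2₃ = 1₃

-- Field arithmetic in characteristic 3

module Char3 {c} (F : FiniteField c) (char3 : HasChar3 F) where

  open FiniteField F renaming (_≟_ to infix 4 _≟_; _⁻¹ to infix 21 _⁻¹)

  commutativeRing : CommutativeRing c c
  commutativeRing = record { isCommutativeRing = isCommutativeRing }

  open CommutativeRing commutativeRing
    using (ring; +-assoc; +-identityˡ; +-identityʳ; *-identityˡ; *-identityʳ; zeroˡ; zeroʳ
          ; -‿inverseˡ; -‿inverseʳ; *-comm; *-assoc)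
  open RingProperties ring
    using (-0#≈0#; -‿involutive; -1*x≈-x; -‿+-comm)

  module Solver₃ where
    ⟦_⟧₃ : 𝔽₃ → Carrier
    ⟦ 0₃ ⟧₃ = 0#
    ⟦ 1₃ ⟧₃ = 1#
    ⟦ 2₃ ⟧₃ = - 1#

    1+1+1≡0 : 1# + (1# + 1#) ≡ 0#
    1+1+1≡0 = trans (cong (λ y → 1# + (1# + y)) (sym (+-identityʳ 1#))) char3

    1+1≡-1 : 1# + 1# ≡ - 1#
    1+1≡-1 = begin
      1# + 1#                    ≡⟨ +-identityˡ _ ⟨
      0# + (1# + 1#)             ≡⟨ cong (_+ (1# + 1#)) (-‿inverseˡ 1#) ⟨
      (- 1# + 1#) + (1# + 1#)    ≡⟨ +-assoc _ _ _ ⟩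
      - 1# + (1# + (1# + 1#))    ≡⟨ cong (- 1# +_) 1+1+1≡0 ⟩
      - 1# + 0#                  ≡⟨ +-identityʳ _ ⟩
      - 1#                       ∎
      where open ≡-Reasoning

    -1+-1≡1 : - 1# + - 1# ≡ 1#
    -1+-1≡1 = trans (-‿+-comm 1# 1#) (trans (cong -_ 1+1≡-1) (-‿involutive 1#))

    open RawRing rawRing₃ using () renaming (_+_ to _+₃_; _*_ to _*₃_; -_ to -₃_)

    +-homo : ∀ x y → ⟦ x +₃ y ⟧₃ ≡ ⟦ x ⟧₃ + ⟦ y ⟧₃
    +-homo 0₃ y  = sym (+-identityˡ _)
    +-homo 1₃ 0₃ = sym (+-identityʳ _)
    +-homo 1₃ 1₃ = sym 1+1≡-1
    +-homo 1₃ 2₃ = sym (-‿inverseʳ _)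
    +-homo 2₃ 0₃ = sym (+-identityʳ _)
    +-homo 2₃ 1₃ = sym (-‿inverseˡ _)
    +-homo 2₃ 2₃ = sym -1+-1≡1

    *-homo : ∀ x y → ⟦ x *₃ y ⟧₃ ≡ ⟦ x ⟧₃ * ⟦ y ⟧₃
    *-homo 0₃ y  = sym (zeroˡ _)
    *-homo 1₃ y  = sym (*-identityˡ _)
    *-homo 2₃ 0₃ = sym (zeroʳ _)
    *-homo 2₃ 1₃ = sym (*-identityʳ _)
    *-homo 2₃ 2₃ = sym (trans (-1*x≈-x _) (-‿involutive _))

    -‿homo : ∀ x → ⟦ -₃ x ⟧₃ ≡ - ⟦ x ⟧₃
    -‿homo 0₃ = sym -0#≈0#
    -‿homo 1₃ = refl
    -‿homo 2₃ = sym (-‿involutive _)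

    morphism : rawRing₃ -Raw-AlmostCommutative⟶ fromCommutativeRing commutativeRing
    morphism = record
      { ⟦_⟧ = ⟦_⟧₃ ; +-homo = +-homo ; *-homo = *-homo ; -‿homo = -‿homo
      ; 0-homo = refl ; 1-homo = refl }

    _coeff≟_ : ∀ x y → Maybe (⟦ x ⟧₃ ≡ ⟦ y ⟧₃)
    0₃ coeff≟ 0₃ = just refl
    1₃ coeff≟ 1₃ = just refl
    2₃ coeff≟ 2₃ = just refl
    _  coeff≟ _  = nothing

    open RingSolver rawRing₃ (fromCommutativeRing commutativeRing) morphism _coeff≟_ public
      using (Polynomial; solve; con; _:+_; _:*_; _:-_; :-_; _:=_)

    infixr 9 _:^_
    -- Unfolds exactly as the power of the field does, ending in 1, so that solver terms evaluate
    -- definitionally to the expressions in `eval` and `Δ`.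
    _:^_ : ∀ {m} → Polynomial m → ℕ → Polynomial m
    p :^ ℕ.zero = con 1₃
    p :^ ℕ.suc n = p :* (p :^ n)

  open Solver₃

  ⁻¹-inverseˡ : ∀ {x} → x ≢ 0# → (x ⁻¹) * x ≡ 1#
  ⁻¹-inverseˡ {x} x≢0 = trans (*-comm (x ⁻¹) x) (⁻¹-inverse x x≢0)

  x*[x⁻¹*y]≡y : ∀ {x} y → x ≢ 0# → x * ((x ⁻¹) * y) ≡ y
  x*[x⁻¹*y]≡y {x} y x≢0 = begin
    x * ((x ⁻¹) * y)  ≡⟨ *-assoc x (x ⁻¹) y ⟨
    x * (x ⁻¹) * y    ≡⟨ cong (_* y) (⁻¹-inverse x x≢0) ⟩
    1# * y            ≡⟨ *-identityˡ y ⟩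
    y                 ∎
    where open ≡-Reasoning

  x⁻¹*[x*y]≡y : ∀ {x} y → x ≢ 0# → (x ⁻¹) * (x * y) ≡ y
  x⁻¹*[x*y]≡y {x} y x≢0 = begin
    (x ⁻¹) * (x * y)  ≡⟨ *-assoc (x ⁻¹) x y ⟨
    (x ⁻¹) * x * y    ≡⟨ cong (_* y) (⁻¹-inverseˡ x≢0) ⟩
    1# * y            ≡⟨ *-identityˡ y ⟩
    y                 ∎
    where open ≡-Reasoning

  *-cancelˡ : ∀ {x y z} → x ≢ 0# → x * y ≡ x * z → y ≡ z
  *-cancelˡ {x} {y} {z} x≢0 eq = begin
    y                 ≡⟨ x⁻¹*[x*y]≡y y x≢0 ⟨
    (x ⁻¹) * (x * y)  ≡⟨ cong ((x ⁻¹) *_) eq ⟩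
    (x ⁻¹) * (x * z)  ≡⟨ x⁻¹*[x*y]≡y z x≢0 ⟩
    z                 ∎
    where open ≡-Reasoning

  x*y≡0⇒x≡0⊎y≡0 : ∀ {x y} → x * y ≡ 0# → x ≡ 0# ⊎ y ≡ 0#
  x*y≡0⇒x≡0⊎y≡0 {x} {y} xy≡0 with x ≟ 0#
  ... | yes x≡0 = inj₁ x≡0
  ... | no x≢0  = inj₂ (*-cancelˡ x≢0 (trans xy≡0 (sym (zeroʳ x))))

  *-≢0 : ∀ {x y} → x ≢ 0# → y ≢ 0# → x * y ≢ 0#
  *-≢0 x≢0 y≢0 = [ x≢0 , y≢0 ]′ ∘ x*y≡0⇒x≡0⊎y≡0

  ⁻¹-≢0 : ∀ {x} → x ≢ 0# → x ⁻¹ ≢ 0#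
  ⁻¹-≢0 {x} x≢0 x⁻¹≡0 = 0≢1 (begin
    0#          ≡⟨ zeroʳ x ⟨
    x * 0#      ≡⟨ cong (x *_) x⁻¹≡0 ⟨
    x * (x ⁻¹)  ≡⟨ ⁻¹-inverse x x≢0 ⟩
    1#          ∎)
    where open ≡-Reasoning

  x-y≡0⇒x≡y : ∀ {x y} → x - y ≡ 0# → x ≡ y
  x-y≡0⇒x≡y {x} {y} eq = begin
    x          ≡⟨ solve 2 (λ x y → x := x :- y :+ y) refl x y ⟩
    x - y + y  ≡⟨ cong (_+ y) eq ⟩
    0# + y     ≡⟨ +-identityˡ y ⟩
    y          ∎
    where open ≡-Reasoning

  x≡y⇒x-y≡0 : ∀ {x y} → x ≡ y → x - y ≡ 0#
  x≡y⇒x-y≡0 {x} refl = -‿inverseʳ x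

  -‿≢0 : ∀ {x} → x ≢ 0# → - x ≢ 0#
  -‿≢0 {x} x≢0 eq = x≢0 (trans (sym (-‿involutive x)) (trans (cong -_ eq) -0#≈0#))

  -- Sums over the field and changes of variable

  ∑F : (Carrier → ℕ) → ℕ
  ∑F = ∑ elements

  ∑F-cong : ∀ {f g} → (∀ x → f x ≡ g x) → ∑F f ≡ ∑F g
  ∑F-cong f≗g = ∑-cong f≗g elements

  ∑F-+ : ∀ f g → ∑F (λ x → f x ℕ.+ g x) ≡ ∑F f ℕ.+ ∑F g
  ∑F-+ f g = ∑-+ f g elements

  ∑F-swap : (h : Carrier → Carrier → ℕ) → ∑F (λ x → ∑F (h x)) ≡ ∑F (λ y → ∑F (λ x → h x y))
  ∑F-swap h = ∑-swap h elements elements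

  ∑F-δ : ∀ f a → ∑F (λ x → 𝟙 (x ≟ a) ℕ.* f x) ≡ f a
  ∑F-δ f a = ∑-δ _≟_ f unique (complete a)

  ∑F-𝟙 : ∀ a → ∑F (λ x → 𝟙 (x ≟ a)) ≡ 1
  ∑F-𝟙 a = trans (∑F-cong (λ x → sym (ℕ.*-identityʳ _))) (∑F-δ (λ _ → 1) a)

  -- Expand f (φ x) as a sum over y of [y = φ x] f y and exchange the sums; bijectivity then reads y
  -- = φ x iff x = ψ y.
  ∑F-reindex : (φ ψ : Carrier → Carrier) → (∀ y → φ (ψ y) ≡ y) → (∀ x → ψ (φ x) ≡ x) →
    ∀ f → ∑F (λ x → f (φ x)) ≡ ∑F f
  ∑F-reindex φ ψ φψ ψφ f = begin
    ∑F (λ x → f (φ x))                              ≡⟨ ∑F-cong (λ x → ∑F-δ f (φ x)) ⟨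
    ∑F (λ x → ∑F (λ y → 𝟙 (y ≟ φ x) ℕ.* f y))       ≡⟨ ∑F-swap _ ⟩
    ∑F (λ y → ∑F (λ x → 𝟙 (y ≟ φ x) ℕ.* f y))
      ≡⟨ ∑F-cong (λ y → ∑F-cong λ x → cong (ℕ._* f y) (𝟙-cong (y ≟ φ x) (x ≟ ψ y)
           (λ { refl → sym (ψφ x) }) (λ { refl → sym (φψ y) }))) ⟩
    ∑F (λ y → ∑F (λ x → 𝟙 (x ≟ ψ y) ℕ.* f y))       ≡⟨ ∑F-cong (λ y → ∑F-δ (λ _ → f y) (ψ y)) ⟩
    ∑F f                                            ∎
    where open ≡-Reasoning

  ∑F-translate : ∀ a f → ∑F (λ x → f (x + a)) ≡ ∑F f
  ∑F-translate a = ∑F-reindex (_+ a) (_- a)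
    (λ y → solve 2 (λ y a → y :- a :+ a := y) refl y a)
    (λ x → solve 2 (λ x a → x :+ a :- a := x) refl x a)

  ∑F-scale : ∀ {a} → a ≢ 0# → ∀ f → ∑F (λ x → f (a * x)) ≡ ∑F f
  ∑F-scale {a} a≢0 = ∑F-reindex (a *_) ((a ⁻¹) *_)
    (λ y → x*[x⁻¹*y]≡y y a≢0) (λ x → x⁻¹*[x*y]≡y x a≢0)

  -- Counting square roots

  √# : Carrier → ℕ
  √# v = ∑F (λ s → 𝟙 (s * s ≟ v))

  s*s≡t*t⇒s≡±t : ∀ {s t} → s * s ≡ t * t → s ≡ t ⊎ s ≡ - t
  s*s≡t*t⇒s≡±t {s} {t} eq with x*y≡0⇒x≡0⊎y≡0 {s - t} {s - (- t)}
    (trans (solve 2 (λ s t → (s :- t) :* (s :- (:- t)) := s :* s :- t :* t) refl s t) (x≡y⇒x-y≡0 eq))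
  ... | inj₁ s-t≡0 = inj₁ (x-y≡0⇒x≡y s-t≡0)
  ... | inj₂ s+t≡0 = inj₂ (x-y≡0⇒x≡y s+t≡0)

  -- If s = -s, then 0 = s - (-s) = 2s, which is -s in characteristic 3.
  s≢0⇒s≢-s : ∀ {s} → s ≢ 0# → s ≢ - s
  s≢0⇒s≢-s {s} s≢0 eq = -‿≢0 s≢0
    (trans (solve 1 (λ s → :- s := s :- (:- s)) refl s) (x≡y⇒x-y≡0 eq))

  -s*-s≡s*s : ∀ s → (- s) * (- s) ≡ s * s
  -s*-s≡s*s = solve 1 (λ s → (:- s) :* (:- s) := s :* s) refl

  s*s≡0⇒s≡0 : ∀ {s} → s * s ≡ 0# → s ≡ 0#
  s*s≡0⇒s≡0 = [ (λ z → z) , (λ z → z) ]′ ∘ x*y≡0⇒x≡0⊎y≡0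

  √#-zero : √# 0# ≡ 1
  √#-zero = trans
    (∑F-cong (λ s → 𝟙-cong (s * s ≟ 0#) (s ≟ 0#) s*s≡0⇒s≡0 (λ { refl → zeroˡ 0# })))
    (∑F-𝟙 0#)

  √#-square : ∀ {t} → t ≢ 0# → √# (t * t) ≡ 2
  √#-square {t} t≢0 = begin
    √# (t * t)                                         ≡⟨ ∑F-cong pointwise ⟩
    ∑F (λ s → 𝟙 (s ≟ t) ℕ.+ 𝟙 (s ≟ - t))               ≡⟨ ∑F-+ _ _ ⟩
    ∑F (λ s → 𝟙 (s ≟ t)) ℕ.+ ∑F (λ s → 𝟙 (s ≟ - t))    ≡⟨ cong₂ ℕ._+_ (∑F-𝟙 t) (∑F-𝟙 (- t)) ⟩
    2                                                  ∎
    where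
    open ≡-Reasoning
    pointwise : ∀ s → 𝟙 (s * s ≟ t * t) ≡ 𝟙 (s ≟ t) ℕ.+ 𝟙 (s ≟ - t)
    pointwise s with s ≟ t | s ≟ - t
    ... | yes refl | yes t≡-t = contradiction t≡-t (s≢0⇒s≢-s t≢0)
    ... | yes refl | no _     = 𝟙-yes (s * s ≟ t * t) refl
    ... | no _     | yes refl = 𝟙-yes (s * s ≟ t * t) (-s*-s≡s*s t)
    ... | no s≢t   | no s≢-t  = 𝟙-no (s * s ≟ t * t) ([ s≢t , s≢-t ]′ ∘ s*s≡t*t⇒s≡±t)

  √#-nonsquare : ∀ {v} → ¬ IsSquare F v → √# v ≡ 0
  √#-nonsquare {v} ¬sq =
    trans (∑F-cong (λ s → 𝟙-no (s * s ≟ v) (λ eq → ¬sq (s , eq)))) (∑-zero elements)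

  isSquare? : ∀ v → Dec (IsSquare F v)
  isSquare? v = decΣ F (λ s → s * s ≟ v)

  √#-nonzeroSquare : ∀ {v} → v ≢ 0# → IsSquare F v → √# v ≡ 2
  √#-nonzeroSquare v≢0 (s , refl) = √#-square (λ { refl → v≢0 (zeroˡ 0#) })

  √#-≤2 : ∀ v → √# v ≤ 2
  √#-≤2 v with v ≟ 0# | isSquare? v
  ... | yes refl | _      = ℕ.≤-trans (ℕ.≤-reflexive √#-zero) (s≤s z≤n)
  ... | no v≢0   | yes sq = ℕ.≤-reflexive (√#-nonzeroSquare v≢0 sq)
  ... | no _     | no ¬sq = ℕ.≤-trans (ℕ.≤-reflexive (√#-nonsquare ¬sq)) z≤n

  √#-scale : ∀ {a} → a ≢ 0# → ∀ v → √# (a * a * v) ≡ √# v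
  √#-scale {a} a≢0 v = begin
    ∑F (λ s → 𝟙 (s * s ≟ a * a * v))          ≡⟨ ∑F-scale a≢0 _ ⟨
    ∑F (λ s → 𝟙 (a * s * (a * s) ≟ a * a * v))
      ≡⟨ ∑F-cong (λ s → 𝟙-cong _ (s * s ≟ v)
           (λ eq → *-cancelˡ (*-≢0 a≢0 a≢0) (trans (sym (regroup s)) eq))
           (λ { refl → regroup s })) ⟩
    √# v                                      ∎
    where
    open ≡-Reasoning
    regroup : ∀ s → a * s * (a * s) ≡ a * a * (s * s)
    regroup = solve 2 (λ a s → a :* s :* (a :* s) := a :* a :* (s :* s)) refl a

  -- Each s is a square root of exactly one value.
  ∑F-√# : ∑F √# ≡ size
  ∑F-√# = begin
    ∑F (λ v → ∑F (λ s → 𝟙 (s * s ≟ v)))    ≡⟨ ∑F-swap _ ⟩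
    ∑F (λ s → ∑F (λ v → 𝟙 (s * s ≟ v)))
      ≡⟨ ∑F-cong (λ s → ∑F-cong λ v → 𝟙-cong (s * s ≟ v) (v ≟ s * s) sym sym) ⟩
    ∑F (λ s → ∑F (λ v → 𝟙 (v ≟ s * s)))    ≡⟨ ∑F-cong (λ s → ∑F-𝟙 (s * s)) ⟩
    ∑F (λ _ → 1)                           ≡⟨ ∑-one elements ⟩
    size                                   ∎
    where open ≡-Reasoning

  square-quotient : ∀ {z v} → v ≢ 0# → IsSquare F v → IsSquare F (z * v) → IsSquare F z
  square-quotient {z} {v} v≢0 (s , refl) (t , eq) = (s ⁻¹) * t , *-cancelˡ v≢0 (begin
    s * s * ((s ⁻¹) * t * ((s ⁻¹) * t))
      ≡⟨ solve 3 (λ s i t → s :* s :* (i :* t :* (i :* t)) := s :* (i :* t) :* (s :* (i :* t)))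
           refl s (s ⁻¹) t ⟩
    s * ((s ⁻¹) * t) * (s * ((s ⁻¹) * t))    ≡⟨ cong₂ _*_ (x*[x⁻¹*y]≡y t s≢0) (x*[x⁻¹*y]≡y t s≢0) ⟩
    t * t                                    ≡⟨ eq ⟩
    z * (s * s)                              ≡⟨ *-comm z (s * s) ⟩
    s * s * z                                ∎)
    where
    open ≡-Reasoning
    s≢0 : s ≢ 0#
    s≢0 refl = v≢0 (zeroˡ 0#)

  -- √# has mean 1, and so has v ↦ √# (z * v); since √# v + √# (z * v) ≤ 2 for every v,
  -- equality holds everywhere.
  √#-nonsquare-multiple : ∀ {z} → ¬ IsSquare F z → ∀ v → √# v ℕ.+ √# (z * v) ≡ 2
  √#-nonsquare-multiple {z} ¬sq v =
    ∑-squeeze bound elements (trans total (sym (∑F-+ (λ _ → 1) (λ _ → 1)))) (complete v)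
    where
    z≢0 : z ≢ 0#
    z≢0 refl = ¬sq (0# , zeroˡ 0#)
    total : ∑F (λ v → √# v ℕ.+ √# (z * v)) ≡ ∑F (λ _ → 1) ℕ.+ ∑F (λ _ → 1)
    total = trans (∑F-+ √# _) (cong₂ ℕ._+_ mean (trans (∑F-scale z≢0 √#) mean))
      where
      mean = trans ∑F-√# (sym (∑-one elements))
    -- For v ≠ 0 at most one of v and z v is a square, since z would otherwise be a quotient of
    -- squares; at v = 0 both counts are 1.
    bound : ∀ v → √# v ℕ.+ √# (z * v) ≤ 2
    bound v with v ≟ 0#
    ... | yes refl = ℕ.≤-reflexive (cong₂ ℕ._+_ √#-zero (trans (cong √# (zeroʳ z)) √#-zero))
    ... | no v≢0 with isSquare? v
    ...   | no ¬v = subst (ℕ._≤ 2) (sym (cong (ℕ._+ √# (z * v)) (√#-nonsquare ¬v))) (√#-≤2 (z * v))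
    ...   | yes v² = subst (ℕ._≤ 2)
      (sym (trans (cong (√# v ℕ.+_) (√#-nonsquare (¬sq ∘ square-quotient v≢0 v²))) (ℕ.+-identityʳ _)))
      (√#-≤2 v)

  nonsquare*nonsquare : ∀ {z v} → ¬ IsSquare F z → ¬ IsSquare F v → √# (z * v) ≡ 2
  nonsquare*nonsquare {z} {v} ¬z ¬v =
    trans (cong (ℕ._+ √# (z * v)) (sym (√#-nonsquare ¬v))) (√#-nonsquare-multiple ¬z v)

  -- Translations and reversal of quartics

  Δₚ : ∀ {m} (z₀ z₁ z₂ z₃ z₄ : Polynomial m) → Polynomial m
  Δₚ z₀ z₁ z₂ z₃ z₄ =
    (z₀ :* z₄ :- z₁ :* z₃) :^ 3 :+ (z₀ :* z₄ :- z₁ :* z₃) :^ 2 :* z₂ :^ 2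
    :- z₂ :^ 3 :* (z₀ :* z₃ :^ 2 :+ z₄ :* z₁ :^ 2 :- z₀ :* z₂ :* z₄)

  evalₚ : ∀ {m} (z₀ z₁ z₂ z₃ z₄ x y : Polynomial m) → Polynomial m
  evalₚ z₀ z₁ z₂ z₃ z₄ x y =
    z₀ :* x :^ 4 :+ z₁ :* x :^ 3 :* y :+ z₂ :* x :^ 2 :* y :^ 2 :+ z₃ :* x :* y :^ 3 :+ z₄ :* y :^ 4

  -- f(X + tY, Y), expanded with 4 = 1, 6 = 0, 3 = 0 and 2 = -1.
  shift : Carrier → Quartic F → Quartic F
  shift t (quartic a b c d e) = quartic a (b + t * a) c (d - t * c + t ^ 3 * a)
    (e + t * d + t ^ 2 * c + t ^ 3 * b + t ^ 4 * a)

  reverse : Quartic F → Quartic F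
  reverse (quartic a b c d e) = quartic e d c b a

  eval-shift : ∀ t f x → eval F (shift t f) x 1# ≡ eval F f (x + t) 1#
  eval-shift t (quartic a b c d e) x = solve 7 (λ a b c d e t x →
     evalₚ a (b :+ t :* a) c (d :- t :* c :+ t :^ 3 :* a)
       (e :+ t :* d :+ t :^ 2 :* c :+ t :^ 3 :* b :+ t :^ 4 :* a) x (con 1₃)
     := evalₚ a b c d e (x :+ t) (con 1₃)) refl a b c d e t x

  Δ-shift : ∀ t f → Δ F (shift t f) ≡ Δ F f
  Δ-shift t (quartic a b c d e) = solve 6 (λ t b d e c a →
     Δₚ a (b :+ t :* a) c (d :- t :* c :+ t :^ 3 :* a)
       (e :+ t :* d :+ t :^ 2 :* c :+ t :^ 3 :* b :+ t :^ 4 :* a)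
     := Δₚ a b c d e) refl t b d e c a

  eval-reverse : ∀ f x y → eval F (reverse f) x y ≡ eval F f y x
  eval-reverse (quartic a b c d e) x y = solve 7 (λ a b c d e x y →
    evalₚ e d c b a x y := evalₚ a b c d e y x) refl a b c d e x y

  Δ-reverse : ∀ f → Δ F (reverse f) ≡ Δ F f
  Δ-reverse (quartic a b c d e) = solve 5 (λ a b c d e →
    Δₚ e d c b a := Δₚ a b c d e) refl a b c d e

  eval-homogeneous : ∀ f l x y → eval F f (l * x) (l * y) ≡ (l * l) * (l * l) * eval F f x y
  eval-homogeneous (quartic a b c d e) l x y = solve 8 (λ a b c d e l x y →
    evalₚ a b c d e (l :* x) (l :* y) := (l :* l) :* (l :* l) :* evalₚ a b c d e x y)
    refl a b c d e l x y

  eval-∞ : ∀ f → eval F f 1# 0# ≡ z0 f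
  eval-∞ (quartic a b c d e) = solve 5 (λ a b c d e →
    evalₚ a b c d e (con 1₃) (con 0₃) := a) refl a b c d e

  -- Sums over the projective line

  ∑PG1 : (Carrier → Carrier → ℕ) → ℕ
  ∑PG1 h = ∑F (λ x → h x 1#) ℕ.+ h 1# 0#

  ∑-PG1 : ∀ h → ∑ (PG1 F) (λ p → h (proj₁ p) (proj₂ p)) ≡ ∑PG1 h
  ∑-PG1 h = trans (∑-++ _ (map (_, 1#) elements) ((1# , 0#) ∷ []))
    (cong₂ ℕ._+_ (∑-map _ (_, 1#) elements) (ℕ.+-identityʳ _))

  ∑PG1-cong : ∀ {g h} → (∀ x y → g x y ≡ h x y) → ∑PG1 g ≡ ∑PG1 h
  ∑PG1-cong g≗h = cong₂ ℕ._+_ (∑F-cong λ x → g≗h x 1#) (g≗h 1# 0#)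

  -- _⁻¹ is unspecified at 0#, so it need not be an involution itself.
  inv : Carrier → Carrier
  inv x with x ≟ 0#
  ... | yes _ = 0#
  ... | no _  = x ⁻¹

  inv-0 : inv 0# ≡ 0#
  inv-0 with 0# ≟ 0#
  ... | yes _ = refl
  ... | no ≢  = contradiction refl ≢

  inv-≢0 : ∀ {x} → x ≢ 0# → inv x ≡ x ⁻¹
  inv-≢0 {x} x≢0 with x ≟ 0#
  ... | yes x≡0 = contradiction x≡0 x≢0
  ... | no _    = refl

  inv-inv : ∀ x → inv (inv x) ≡ x
  inv-inv x with x ≟ 0#
  ... | yes refl = inv-0
  ... | no x≢0   = trans (inv-≢0 (⁻¹-≢0 x≢0)) (*-cancelˡ (⁻¹-≢0 x≢0)
    (trans (⁻¹-inverse (x ⁻¹) (⁻¹-≢0 x≢0)) (sym (⁻¹-inverseˡ x≢0))))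

  punctured : (Carrier → ℕ) → Carrier → ℕ
  punctured h x with x ≟ 0#
  ... | yes _ = 0
  ... | no _  = h x

  ∑F-punctured : ∀ h → ∑F h ≡ h 0# ℕ.+ ∑F (punctured h)
  ∑F-punctured h = begin
    ∑F h                                                     ≡⟨ ∑F-cong split ⟩
    ∑F (λ x → 𝟙 (x ≟ 0#) ℕ.* h x ℕ.+ punctured h x)          ≡⟨ ∑F-+ _ _ ⟩
    ∑F (λ x → 𝟙 (x ≟ 0#) ℕ.* h x) ℕ.+ ∑F (punctured h)       ≡⟨ cong (ℕ._+ ∑F (punctured h)) (∑F-δ h 0#) ⟩
    h 0# ℕ.+ ∑F (punctured h)                                ∎
    where
    open ≡-Reasoning
    split : ∀ x → h x ≡ 𝟙 (x ≟ 0#) ℕ.* h x ℕ.+ punctured h x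
    split x with x ≟ 0#
    ... | yes _ = sym (trans (ℕ.+-identityʳ _) (ℕ.+-identityʳ _))
    ... | no _  = refl

  -- The swap exchanges 0 and ∞ and inverts the remaining points: (1 : x⁻¹), rescaled by x, is (x :
  -- 1).
  ∑PG1-flip : ∀ h → (∀ {l} → l ≢ 0# → ∀ x y → h (l * x) (l * y) ≡ h x y) →
    ∑PG1 (λ x y → h y x) ≡ ∑PG1 h
  ∑PG1-flip h homogeneous = begin
    ∑F (h 1#) ℕ.+ h 0# 1#                                 ≡⟨ cong (ℕ._+ h 0# 1#) (∑F-punctured (h 1#)) ⟩
    h 1# 0# ℕ.+ ∑F (punctured (h 1#)) ℕ.+ h 0# 1#
      ≡⟨ cong (λ n → h 1# 0# ℕ.+ n ℕ.+ h 0# 1#)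
           (trans (sym (∑F-reindex inv inv inv-inv inv-inv _)) (∑F-cong flipped)) ⟩
    h 1# 0# ℕ.+ ∑F (punctured (λ x → h x 1#)) ℕ.+ h 0# 1# ≡⟨ ℕ.+-assoc (h 1# 0#) _ _ ⟩
    h 1# 0# ℕ.+ (∑F (punctured (λ x → h x 1#)) ℕ.+ h 0# 1#) ≡⟨ cong (h 1# 0# ℕ.+_) (ℕ.+-comm _ (h 0# 1#)) ⟩
    h 1# 0# ℕ.+ (h 0# 1# ℕ.+ ∑F (punctured (λ x → h x 1#))) ≡⟨ cong (h 1# 0# ℕ.+_) (∑F-punctured (λ x → h x 1#)) ⟨
    h 1# 0# ℕ.+ ∑F (λ x → h x 1#)                         ≡⟨ ℕ.+-comm (h 1# 0#) _ ⟩
    ∑F (λ x → h x 1#) ℕ.+ h 1# 0#                         ∎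
    where
    open ≡-Reasoning
    flipped : ∀ x → punctured (h 1#) (inv x) ≡ punctured (λ x → h x 1#) x
    flipped x with x ≟ 0#
    flipped x | yes refl with 0# ≟ 0#
    ... | yes _ = refl
    ... | no ≢  = contradiction refl ≢
    flipped x | no x≢0 with x ⁻¹ ≟ 0#
    ... | yes x⁻¹≡0 = contradiction x⁻¹≡0 (⁻¹-≢0 x≢0)
    ... | no _ = trans (sym (homogeneous x≢0 1# (x ⁻¹))) (cong₂ h (*-identityʳ x) (⁻¹-inverse x x≢0))

  -- Independent of the representatives of projective points: rescaling by l multiplies f by l⁴, the
  -- square of l².
  #C : Quartic F → ℕ
  #C f = ∑PG1 (λ x y → √# (eval F f x y))

  #C-shift : ∀ t f → #C (shift t f) ≡ #C f
  #C-shift t f@(quartic _ _ _ _ _) = cong₂ ℕ._+_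
    (trans (∑F-cong (λ x → cong √# (eval-shift t f x))) (∑F-translate t (λ x → √# (eval F f x 1#))))
    (cong √# (trans (eval-∞ (shift t f)) (sym (eval-∞ f))))

  #C-reverse : ∀ f → #C (reverse f) ≡ #C f
  #C-reverse f = trans (∑PG1-cong (λ x y → cong √# (eval-reverse f x y)))
    (∑PG1-flip (λ x y → √# (eval F f x y)) λ {l} l≢0 x y →
      trans (cong √# (eval-homogeneous f l x y)) (√#-scale (*-≢0 l≢0 l≢0) (eval F f x y)))

  -- The affine points of S² = T³ + T² - δ.
  #W : Carrier → ℕ
  #W δ = ∑F (λ t → √# (t ^ 3 + t ^ 2 - δ))

  #W-substitute : ∀ {a} → a ≢ 0# → ∀ b δ →
    #W δ ≡ ∑F (λ x → √# ((a * x + b) ^ 3 + (a * x + b) ^ 2 - δ))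
  #W-substitute a≢0 b δ = sym (trans (∑F-scale a≢0 (λ y → g (y + b))) (∑F-translate b g))
    where
    g : Carrier → ℕ
    g t = √# (t ^ 3 + t ^ 2 - δ)

  -- Multiplying by b² and setting T = b x - b d gives the Weierstrass form, and the zero of f at
  -- infinity is the extra point. If b were 0, f would have a double zero there.
  #C-cubic : ∀ f → z0 f ≡ 0# → z2 f ≡ 1# → Δ F f ≢ 0# → #C f ≡ #W (Δ F f) ℕ.+ 1
  #C-cubic f@(quartic _ b _ d e) refl refl Δ≢0 = cong₂ ℕ._+_
    (trans (∑F-cong (λ x → trans (sym (√#-scale b≢0 _)) (cong √# (identity x))))
      (sym (#W-substitute b≢0 (- (b * d)) (Δ F f))))
    (trans (cong √# (eval-∞ f)) √#-zero)
    where
    b≢0 : b ≢ 0#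
    b≢0 refl = Δ≢0 (solve 2 (λ d e → Δₚ (con 0₃) (con 0₃) (con 1₃) d e := con 0₃) refl d e)
    identity : ∀ x → b * b * eval F f x 1# ≡ (b * x + - (b * d)) ^ 3 + (b * x + - (b * d)) ^ 2 - Δ F f
    identity x = solve 4 (λ b d e x →
      b :* b :* evalₚ (con 0₃) b (con 1₃) d e x (con 1₃) :=
      (b :* x :+ :- (b :* d)) :^ 3 :+ (b :* x :+ :- (b :* d)) :^ 2 :- Δₚ (con 0₃) b (con 1₃) d e)
      refl b d e x

  -- Quartics without an X³Y term

  quadratic-roots : ∀ {α} → α ≢ 0# → ∀ b γ →
    ∑F (λ x → 𝟙 (α * (x * x) - b * x + γ ≟ 0#)) ≡ √# (b * b - α * γ)
  quadratic-roots {α} α≢0 b γ = sym (begin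
    ∑F (λ v → 𝟙 (v * v ≟ b * b - α * γ))                       ≡⟨ ∑F-translate b _ ⟨
    ∑F (λ v → 𝟙 ((v + b) * (v + b) ≟ b * b - α * γ))           ≡⟨ ∑F-scale α≢0 _ ⟨
    ∑F (λ x → 𝟙 ((α * x + b) * (α * x + b) ≟ b * b - α * γ))
      ≡⟨ ∑F-cong (λ x → 𝟙-cong _ (α * (x * x) - b * x + γ ≟ 0#)
          (λ eq → *-cancelˡ α≢0 (trans (completed x) (trans (x≡y⇒x-y≡0 eq) (sym (zeroʳ α)))))
          (λ eq → x-y≡0⇒x≡y (trans (sym (completed x)) (trans (cong (α *_) eq) (zeroʳ α))))) ⟩
    ∑F (λ x → 𝟙 (α * (x * x) - b * x + γ ≟ 0#))                ∎)
    where
    open ≡-Reasoning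
    -- In characteristic 3 the usual 4α and 2αx - b are α and -(αx + b).
    completed : ∀ x → α * (α * (x * x) - b * x + γ) ≡ (α * x + b) * (α * x + b) - (b * b - α * γ)
    completed = solve 4 (λ α b γ x → α :* (α :* (x :* x) :- b :* x :+ γ) :=
      (α :* x :+ b) :* (α :* x :+ b) :- (b :* b :- α :* γ)) refl α b γ

  linear-roots : ∀ {b} → b ≢ 0# → ∀ γ → ∑F (λ x → 𝟙 (b * x + γ ≟ 0#)) ≡ 1
  linear-roots {b} b≢0 γ = trans (trans
    (∑F-scale b≢0 (λ y → 𝟙 (y + γ ≟ 0#)))
    (∑F-translate γ (λ y → 𝟙 (y ≟ 0#)))) (∑F-𝟙 0#)

  -- The substitution s = u + x² turns a s² = a x⁴ + x² + b x + d into
  -- -(a u + 1) x² - b x + (a u² - d) = 0, a quadratic in x.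
  module Depressed (a b d : Carrier) (a≢0 : a ≢ 0#) (Δ≢0 : Δ F (quartic a 0# 1# b d) ≢ 0#) where

    f : Quartic F
    f = quartic a 0# 1# b d

    α γ disc : Carrier → Carrier
    α u = - (a * u + 1#)
    γ u = a * (u * u) - d
    disc u = b * b - α u * γ u

    -- Points are counted on the twist a s² = f, where s = u + x² cancels a x⁴ whether or not a is a
    -- square.
    #M : ℕ
    #M = ∑F (λ x → ∑F (λ s → 𝟙 (a * (s * s) ≟ eval F f x 1#)))

    private
      -- The only u at which the coefficient α of x² vanishes.
      u₀ : Carrier
      u₀ = - a ⁻¹

      α-u₀ : α u₀ ≡ 0#
      α-u₀ = begin
        - (a * - a ⁻¹ + 1#)  ≡⟨ solve 2 (λ a i → :- (a :* :- i :+ con 1₃) := a :* i :- con 1₃) refl a (a ⁻¹) ⟩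
        a * a ⁻¹ - 1#        ≡⟨ x≡y⇒x-y≡0 (⁻¹-inverse a a≢0) ⟩
        0#                   ∎
        where open ≡-Reasoning

      α≡0⇒u₀ : ∀ u → α u ≡ 0# → u ≡ u₀
      α≡0⇒u₀ u αu≡0 = *-cancelˡ a≢0 (x-y≡0⇒x≡y (begin
        a * u - a * u₀
          ≡⟨ solve 3 (λ a u v →
               a :* u :- a :* v := :- (a :* v :+ con 1₃) :- :- (a :* u :+ con 1₃)) refl a u u₀ ⟩
        α u₀ - α u      ≡⟨ x≡y⇒x-y≡0 (trans α-u₀ (sym αu≡0)) ⟩
        0#              ∎))
        where open ≡-Reasoning

      -- With b = 0, d = a u² and m = a u one has Δ = m⁶ + m⁴ + m² = m² (m² - 1)², and a u₀ = -1.
      γ-u₀≢0 : b ≡ 0# → γ u₀ ≢ 0#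
      γ-u₀≢0 b≡0 γ≡0 = Δ≢0 (begin
        Δ F f
          ≡⟨ cong₂ (λ b d → Δ F (quartic a 0# 1# b d)) b≡0 (sym (x-y≡0⇒x≡y γ≡0)) ⟩
        Δ F (quartic a 0# 1# 0# (a * (u₀ * u₀)))
          ≡⟨ solve 2 (λ a u → Δₚ a (con 0₃) (con 1₃) (con 0₃) (a :* (u :* u)) :=
               :- (a :* u :+ con 1₃) :*
               ((a :* u :+ con 1₃) :* (con 1₃ :- a :* u) :* (a :* u) :* (a :* u) :* (a :* u :- con 1₃)))
               refl a u₀ ⟩
        α u₀ * cofactor  ≡⟨ cong (_* cofactor) α-u₀ ⟩
        0# * cofactor    ≡⟨ zeroˡ cofactor ⟩
        0#               ∎)
        where
        open ≡-Reasoning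
        cofactor : Carrier
        cofactor = (a * u₀ + 1#) * (1# - a * u₀) * (a * u₀) * (a * u₀) * (a * u₀ - 1#)

    -- The indicator repairs the degenerate fibre, where the discriminant is b². For b ≠ 0 the
    -- equation is linear with one root, against two square roots of b². For b = 0 it is a nonzero
    -- constant with no root, against one square root of 0. The deficit is one in both cases.
    fibre : ∀ u → ∑F (λ x → 𝟙 (α u * (x * x) - b * x + γ u ≟ 0#)) ℕ.+ 𝟙 (u ≟ u₀) ≡ √# (disc u)
    fibre u with u ≟ u₀
    ... | no u≢u₀ = trans (ℕ.+-identityʳ _) (quadratic-roots (u≢u₀ ∘ α≡0⇒u₀ u) b (γ u))
    ... | yes refl with b ≟ 0#
    ...   | no b≢0 = begin
      ∑F (λ x → 𝟙 (α u * (x * x) - b * x + γ u ≟ 0#)) ℕ.+ 1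
        ≡⟨ cong (ℕ._+ 1) (∑F-cong λ x → cong (λ y → 𝟙 (y ≟ 0#)) (degenerate x)) ⟩
      ∑F (λ x → 𝟙 (- b * x + γ u ≟ 0#)) ℕ.+ 1  ≡⟨ cong (ℕ._+ 1) (linear-roots (-‿≢0 b≢0) (γ u)) ⟩
      2                                        ≡⟨ √#-square b≢0 ⟨
      √# (b * b)                               ≡⟨ cong √# disc≡b² ⟨
      √# (disc u)                              ∎
      where
      open ≡-Reasoning
      degenerate : ∀ x → α u * (x * x) - b * x + γ u ≡ - b * x + γ u
      degenerate x = trans (cong (λ y → y * (x * x) - b * x + γ u) α-u₀)
        (solve 3 (λ b x g → con 0₃ :* (x :* x) :- b :* x :+ g := :- b :* x :+ g) refl b x (γ u))
      disc≡b² : disc u ≡ b * b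
      disc≡b² = trans (cong (λ y → b * b - y * γ u) α-u₀)
        (solve 2 (λ b g → b :* b :- con 0₃ :* g := b :* b) refl b (γ u))
    ...   | yes refl = begin
      ∑F (λ x → 𝟙 (α u * (x * x) - 0# * x + γ u ≟ 0#)) ℕ.+ 1
        ≡⟨ cong (ℕ._+ 1) (∑F-cong λ x → 𝟙-no _ (γ-u₀≢0 refl ∘ trans (sym (constant x)))) ⟩
      ∑F (λ _ → 0) ℕ.+ 1                       ≡⟨ cong (ℕ._+ 1) (∑-zero elements) ⟩
      1                                        ≡⟨ √#-zero ⟨
      √# 0#                                    ≡⟨ cong √# disc≡0 ⟨
      √# (disc u)                              ∎
      where
      open ≡-Reasoning
      constant : ∀ x → α u * (x * x) - 0# * x + γ u ≡ γ u
      constant x = trans (cong (λ y → y * (x * x) - 0# * x + γ u) α-u₀)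
        (solve 2 (λ x g → con 0₃ :* (x :* x) :- con 0₃ :* x :+ g := g) refl x (γ u))
      disc≡0 : disc u ≡ 0#
      disc≡0 = trans (cong (λ y → 0# * 0# - y * γ u) α-u₀)
        (solve 1 (λ g → con 0₃ :* con 0₃ :- con 0₃ :* g := con 0₃) refl (γ u))

    -- Double counting of the pairs (x, u): for fixed x, u is a translate of s; for fixed u, `fibre`
    -- counts x. The added 1 is the total of the corrections at `u₀`.
    #M+1 : #M ℕ.+ 1 ≡ ∑F (λ u → √# (disc u))
    #M+1 = begin
      #M ℕ.+ 1
        ≡⟨ cong (ℕ._+ 1) (∑F-cong λ x → trans (sym (∑F-translate (x * x) _)) (∑F-cong λ u → substitute x u)) ⟩
      ∑F (λ x → ∑F (λ u → 𝟙 (α u * (x * x) - b * x + γ u ≟ 0#))) ℕ.+ 1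
        ≡⟨ cong₂ ℕ._+_ (∑F-swap _) (sym (∑F-𝟙 u₀)) ⟩
      ∑F (λ u → ∑F (λ x → 𝟙 (α u * (x * x) - b * x + γ u ≟ 0#))) ℕ.+ ∑F (λ u → 𝟙 (u ≟ u₀))
        ≡⟨ ∑F-+ _ _ ⟨
      ∑F (λ u → ∑F (λ x → 𝟙 (α u * (x * x) - b * x + γ u ≟ 0#)) ℕ.+ 𝟙 (u ≟ u₀))
        ≡⟨ ∑F-cong fibre ⟩
      ∑F (λ u → √# (disc u))
        ∎
      where
      open ≡-Reasoning
      difference : ∀ x u → a * ((u + x * x) * (u + x * x)) - eval F f x 1# ≡ α u * (x * x) - b * x + γ u
      difference x u = solve 5 (λ a b d x u →
        a :* ((u :+ x :* x) :* (u :+ x :* x)) :- evalₚ a (con 0₃) (con 1₃) b d x (con 1₃) :=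
        :- (a :* u :+ con 1₃) :* (x :* x) :- b :* x :+ (a :* (u :* u) :- d)) refl a b d x u
      substitute : ∀ x u → 𝟙 (a * ((u + x * x) * (u + x * x)) ≟ eval F f x 1#)
        ≡ 𝟙 (α u * (x * x) - b * x + γ u ≟ 0#)
      substitute x u = 𝟙-cong _ _
        (λ eq → trans (sym (difference x u)) (x≡y⇒x-y≡0 eq))
        (λ eq → x-y≡0⇒x≡y (trans (difference x u) eq))

    ∃-square : ¬ (¬ IsSquare F a × (∀ x → ¬ IsSquare F (eval F f x 1#)))
    ∃-square (¬a , ¬f) = ℕ.1+n≰n (begin
      ℕ.suc (∑F (λ _ → 2))   ≡⟨ cong ℕ.suc (∑F-cong λ x → twist x) ⟨
      ℕ.suc #M               ≡⟨ ℕ.+-comm 1 #M ⟩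
      #M ℕ.+ 1               ≡⟨ #M+1 ⟩
      ∑F (λ u → √# (disc u)) ≤⟨ ∑-mono-≤ (√#-≤2 ∘ disc) elements ⟩
      ∑F (λ _ → 2)           ∎)
      where
      open ℕ.≤-Reasoning
      regroup : ∀ s → a * s * (a * s) ≡ a * (a * (s * s))
      regroup = solve 2 (λ a s → a :* s :* (a :* s) := a :* (a :* (s :* s))) refl a
      -- Multiplication by a turns a s² = f(x) into (a s)² = a f(x), whose right side is a product
      -- of two nonsquares.
      twist : ∀ x → ∑F (λ s → 𝟙 (a * (s * s) ≟ eval F f x 1#)) ≡ 2
      twist x = trans (trans (∑F-cong (λ s → 𝟙-cong _ _
          (λ eq → trans (regroup s) (cong (a *_) eq))
          (λ eq → *-cancelˡ a≢0 (trans (sym (regroup s)) eq))))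
        (∑F-scale a≢0 (λ s → 𝟙 (s * s ≟ a * eval F f x 1#))))
        (nonsquare*nonsquare ¬a (¬f x))

    -- With a = r², scaling s by r identifies the twist with s² = f. Two points lie at infinity: one
    -- completes `#M+1`, the other is the point at infinity of the cubic. Multiplying `disc u` by a
    -- = r² keeps the root count and gives the cubic in T = a u + a d.
    #C-depressed : IsSquare F a → #C f ≡ #W (Δ F f) ℕ.+ 1
    #C-depressed (r , r*r≡a) = begin
      ∑F (λ x → √# (eval F f x 1#)) ℕ.+ √# (eval F f 1# 0#)
        ≡⟨ cong₂ ℕ._+_ (∑F-cong λ x → sym (untwist x))
             (trans (cong √# (eval-∞ f)) (√#-nonzeroSquare a≢0 (r , r*r≡a))) ⟩
      #M ℕ.+ 2                         ≡⟨ ℕ.+-assoc #M 1 1 ⟨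
      #M ℕ.+ 1 ℕ.+ 1                   ≡⟨ cong (ℕ._+ 1) #M+1 ⟩
      ∑F (λ u → √# (disc u)) ℕ.+ 1
        ≡⟨ cong (ℕ._+ 1) (∑F-cong λ u →
             trans (sym (√#-scale r≢0 (disc u))) (cong √# (weierstrass u))) ⟩
      ∑F (λ u → √# ((a * u + a * d) ^ 3 + (a * u + a * d) ^ 2 - Δ F f)) ℕ.+ 1
                                       ≡⟨ cong (ℕ._+ 1) (#W-substitute a≢0 (a * d) (Δ F f)) ⟨
      #W (Δ F f) ℕ.+ 1                 ∎
      where
      open ≡-Reasoning
      r≢0 : r ≢ 0#
      r≢0 refl = a≢0 (trans (sym r*r≡a) (zeroˡ 0#))
      regroup : ∀ s → r * s * (r * s) ≡ a * (s * s)
      regroup s = trans (solve 2 (λ r s → r :* s :* (r :* s) := r :* r :* (s :* s)) refl r s)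
        (cong (_* (s * s)) r*r≡a)
      untwist : ∀ x → ∑F (λ s → 𝟙 (a * (s * s) ≟ eval F f x 1#)) ≡ √# (eval F f x 1#)
      untwist x = trans (∑F-cong (λ s → cong (λ y → 𝟙 (y ≟ eval F f x 1#)) (sym (regroup s))))
        (∑F-scale r≢0 (λ s → 𝟙 (s * s ≟ eval F f x 1#)))
      weierstrass : ∀ u → r * r * disc u ≡ (a * u + a * d) ^ 3 + (a * u + a * d) ^ 2 - Δ F f
      weierstrass u = trans (cong (_* disc u) r*r≡a) (solve 4 (λ a b d u →
        a :* (b :* b :- :- (a :* u :+ con 1₃) :* (a :* (u :* u) :- d)) :=
        (a :* u :+ a :* d) :^ 3 :+ (a :* u :+ a :* d) :^ 2
        :- Δₚ a (con 0₃) (con 1₃) b d) refl a b d u)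

  -- Moving a square value to infinity

  depress : ∀ f → z0 f ≢ 0# → Σ Carrier λ t → z1 (shift t f) ≡ 0#
  depress f@(quartic a b _ _ _) a≢0 = a ⁻¹ * (- b) , (begin
    b + a ⁻¹ * (- b) * a    ≡⟨ cong (b +_) (trans (*-comm _ a) (x*[x⁻¹*y]≡y (- b) a≢0)) ⟩
    b - b                   ≡⟨ -‿inverseʳ b ⟩
    0#                      ∎)
    where open ≡-Reasoning

  #C-square-at-∞ : ∀ f → z2 f ≡ 1# → Δ F f ≢ 0# → IsSquare F (z0 f) → #C f ≡ #W (Δ F f) ℕ.+ 1
  #C-square-at-∞ f@(quartic a _ _ _ _) z2≡1 Δ≢0 sq with a ≟ 0#
  ... | yes a≡0 = #C-cubic f a≡0 z2≡1 Δ≢0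
  ... | no a≢0 with depress f a≢0
  ...   | t , z1≡0 = begin
    #C f                             ≡⟨ #C-shift t f ⟨
    #C (shift t f)                   ≡⟨ depressed (shift t f) z1≡0 z2≡1 a≢0
                                          (Δ≢0 ∘ trans (sym (Δ-shift t f))) sq ⟩
    #W (Δ F (shift t f)) ℕ.+ 1       ≡⟨ cong (λ δ → #W δ ℕ.+ 1) (Δ-shift t f) ⟩
    #W (Δ F f) ℕ.+ 1                 ∎
    where
    open ≡-Reasoning
    -- Stated for a form with variable coefficients, so that the equations for z1 and z2 can be
    -- matched by `refl`; in `shift t f` the coefficient z1 is a compound term.
    depressed : ∀ g → z1 g ≡ 0# → z2 g ≡ 1# → z0 g ≢ 0# → Δ F g ≢ 0# → IsSquare F (z0 g) →
      #C g ≡ #W (Δ F g) ℕ.+ 1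
    depressed (quartic a _ _ b d) refl refl a≢0 Δ≢0 = Depressed.#C-depressed a b d a≢0 Δ≢0

  -- Zero counts as a square here: a zero of f will serve, and moving it to infinity leads to the
  -- cubic case.
  square-value : ∀ f → z2 f ≡ 1# → Δ F f ≢ 0# →
    IsSquare F (z0 f) ⊎ Σ Carrier λ x → IsSquare F (eval F f x 1#)
  square-value f@(quartic a _ _ _ _) z2≡1 Δ≢0 with isSquare? a | decΣ F (λ x → isSquare? (eval F f x 1#))
  ... | yes sq | _      = inj₁ sq
  ... | no _   | yes sq = inj₂ sq
  ... | no ¬a  | no ¬f  with depress f (λ { refl → ¬a (0# , zeroˡ 0#) })
  ...   | t , z1≡0 = contradiction (¬a , λ x → ¬f ∘ λ sq → x + t , subst (IsSquare F) (eval-shift t f x) sq)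
    (depressed (shift t f) z1≡0 z2≡1 (λ { refl → ¬a (0# , zeroˡ 0#) }) (Δ≢0 ∘ trans (sym (Δ-shift t f))))
    where
    depressed : ∀ g → z1 g ≡ 0# → z2 g ≡ 1# → z0 g ≢ 0# → Δ F g ≢ 0# →
      ¬ (¬ IsSquare F (z0 g) × (∀ x → ¬ IsSquare F (eval F g x 1#)))
    depressed (quartic a _ _ b d) refl refl a≢0 Δ≢0 = Depressed.∃-square a b d a≢0 Δ≢0

  -- The translation carries (x : 1) to (0 : 1), and the reversal carries that to (1 : 0).
  to-∞ : Carrier → Quartic F → Quartic F
  to-∞ x f = reverse (shift x f)

  z0-to-∞ : ∀ x f → z0 (to-∞ x f) ≡ eval F f x 1#
  z0-to-∞ x (quartic a b c d e) = solve 6 (λ a b c d e t →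
    e :+ t :* d :+ t :^ 2 :* c :+ t :^ 3 :* b :+ t :^ 4 :* a := evalₚ a b c d e t (con 1₃))
    refl a b c d e x

  Δ-to-∞ : ∀ x f → Δ F (to-∞ x f) ≡ Δ F f
  Δ-to-∞ x f = trans (Δ-reverse (shift x f)) (Δ-shift x f)

  #C≡#W+1 : ∀ f → z2 f ≡ 1# → Δ F f ≢ 0# → #C f ≡ #W (Δ F f) ℕ.+ 1
  #C≡#W+1 f z2≡1 Δ≢0 with square-value f z2≡1 Δ≢0
  ... | inj₁ sq = #C-square-at-∞ f z2≡1 Δ≢0 sq
  ... | inj₂ (x , sq) = begin
    #C f                         ≡⟨ #C-shift x f ⟨
    #C (shift x f)               ≡⟨ #C-reverse (shift x f) ⟨
    #C (to-∞ x f)                ≡⟨ #C-square-at-∞ (to-∞ x f) z2≡1 (Δ≢0 ∘ trans (sym (Δ-to-∞ x f)))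
                                      (subst (IsSquare F) (sym (z0-to-∞ x f)) sq) ⟩
    #W (Δ F (to-∞ x f)) ℕ.+ 1    ≡⟨ cong (λ δ → #W δ ℕ.+ 1) (Δ-to-∞ x f) ⟩
    #W (Δ F f) ℕ.+ 1             ∎
    where open ≡-Reasoning

  -- Comparison with the projective curve

  -- On the line z = 0 the equation becomes t³ = 0, which leaves only (1 : 0 : 0).
  #E≡#W+1 : ∀ r → #E F r ≡ #W (r ⁻¹) ℕ.+ 1
  #E≡#W+1 r = begin
    #E F r                                            ≡⟨ length-filter _ (PG2 F) ⟩
    ∑ (PG2 F) _                                       ≡⟨ ∑-++ _ (concatMap _ elements) _ ⟩
    ∑ (concatMap _ elements) _ ℕ.+ ∑ (map (λ s → s , 1# , 0#) elements ++ (1# , 0# , 0#) ∷ []) _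
      ≡⟨ cong₂ ℕ._+_ affine (trans (∑-++ _ (map (λ s → s , 1# , 0#) elements) _) (cong₂ ℕ._+_ line point)) ⟩
    #W (r ⁻¹) ℕ.+ 1                                   ∎
    where
    open ≡-Reasoning
    affine = trans (∑-concatMap _ _ elements) (trans (∑F-cong λ s → trans (∑-map _ _ elements) (∑F-cong λ t →
      𝟙-cong _ (s * s ≟ t ^ 3 + t ^ 2 - r ⁻¹)
        (λ eq → trans (lhs s) (trans eq (rhs t)))
        (λ eq → trans (sym (lhs s)) (trans eq (sym (rhs t)))))) (∑F-swap _))
      where
      lhs : ∀ s → s * s ≡ s ^ 2 * 1#
      lhs = solve 1 (λ s → s :* s := s :^ 2 :* con 1₃) refl
      rhs : ∀ t → t ^ 3 + t ^ 2 * 1# - r ⁻¹ * 1# ^ 3 ≡ t ^ 3 + t ^ 2 - r ⁻¹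
      rhs t = solve 2 (λ t r →
        t :^ 3 :+ t :^ 2 :* con 1₃ :- r :* con 1₃ :^ 3 := t :^ 3 :+ t :^ 2 :- r) refl t (r ⁻¹)
    line = trans (∑-map _ _ elements) (trans (∑F-cong λ s → 𝟙-no _ λ eq → 0≢1
      (trans (solve 1 (λ s → con 0₃ := s :^ 2 :* con 0₃) refl s) (trans eq
        (solve 1 (λ r → con 1₃ :^ 3 :+ con 1₃ :^ 2 :* con 0₃ :- r :* con 0₃ :^ 3 := con 1₃) refl (r ⁻¹)))))
      (∑-zero elements))
    point = trans (ℕ.+-identityʳ _) (𝟙-yes _ (solve 1 (λ r →
      con 1₃ :^ 2 :* con 0₃ := con 0₃ :^ 3 :+ con 0₃ :^ 2 :* con 0₃ :- r :* con 0₃ :^ 3) refl (r ⁻¹)))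

  -- For z2 = 1 the invariant is ȷ = Δ⁻¹, so the constant of the curve with r = ȷ is the one reached
  -- from f.
  ȷ⁻¹≡Δ : ∀ f → z2 f ≡ 1# → Δ F f ≢ 0# → ȷ F f ≢ 0# → ȷ F f ⁻¹ ≡ Δ F f
  ȷ⁻¹≡Δ f@(quartic _ _ _ _ _) refl Δ≢0 ȷ≢0 = *-cancelˡ ȷ≢0 (begin
    ȷ F f * ȷ F f ⁻¹     ≡⟨ ⁻¹-inverse _ ȷ≢0 ⟩
    1#                   ≡⟨ ⁻¹-inverseˡ Δ≢0 ⟨
    Δ F f ⁻¹ * Δ F f     ≡⟨ solve 2 (λ i d → i :* d := con 1₃ :^ 6 :* i :* d) refl (Δ F f ⁻¹) (Δ F f) ⟩
    ȷ F f * Δ F f        ∎)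
    where open ≡-Reasoning

  #C≡#E : ∀ f → Δ F f ≢ 0# → ȷ F f ≢ 0# → z2 f ≡ 1# → #C f ≡ #E F (ȷ F f)
  #C≡#E f Δ≢0 ȷ≢0 z2≡1 = begin
    #C f                       ≡⟨ #C≡#W+1 f z2≡1 Δ≢0 ⟩
    #W (Δ F f) ℕ.+ 1           ≡⟨ cong (λ δ → #W δ ℕ.+ 1) (ȷ⁻¹≡Δ f z2≡1 Δ≢0 ȷ≢0) ⟨
    #W (ȷ F f ⁻¹) ℕ.+ 1        ≡⟨ #E≡#W+1 (ȷ F f) ⟨
    #E F (ȷ F f)               ∎
    where open ≡-Reasoning

  -- Zeros of forms on the projective line

  #zeros : (Carrier → Carrier → Carrier) → ℕ
  #zeros h = ∑PG1 (λ x y → 𝟙 (h x y ≟ 0#))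

  #C≡2ζ+#zeros : ∀ f → #C f ≡ 2 ℕ.* ζ F f ℕ.+ #zeros (eval F f)
  #C≡2ζ+#zeros f = begin
    #C f
      ≡⟨ ∑-PG1 (λ x y → √# (eval F f x y)) ⟨
    ∑ (PG1 F) (λ p → √# (v p))
      ≡⟨ ∑-cong (λ p → classify (v p ≟ 0#) (nonzeroSquare? F (v p))) (PG1 F) ⟩
    ∑ (PG1 F) (λ p → 2 ℕ.* 𝟙 (nonzeroSquare? F (v p)) ℕ.+ 𝟙 (v p ≟ 0#))
      ≡⟨ ∑-+ _ _ (PG1 F) ⟩
    ∑ (PG1 F) (λ p → 2 ℕ.* 𝟙 (nonzeroSquare? F (v p))) ℕ.+ ∑ (PG1 F) (λ p → 𝟙 (v p ≟ 0#))
      ≡⟨ cong₂ ℕ._+_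
           (trans (∑-*ˡ 2 _ (PG1 F)) (cong (2 ℕ.*_) (sym (length-filter (nonzeroSquare? F ∘ v) (PG1 F)))))
           (∑-PG1 (λ x y → 𝟙 (eval F f x y ≟ 0#))) ⟩
    2 ℕ.* ζ F f ℕ.+ #zeros (eval F f) ∎
    where
    open ≡-Reasoning
    v : Carrier × Carrier → Carrier
    v p = eval F f (proj₁ p) (proj₂ p)
    classify : ∀ {w} (z : Dec (w ≡ 0#)) (n : Dec (NonzeroSquare F w)) → √# w ≡ 2 ℕ.* 𝟙 n ℕ.+ 𝟙 z
    classify (yes w≡0)  (yes (w≢0 , _)) = contradiction w≡0 w≢0
    classify (yes refl) (no _)          = √#-zero
    classify (no _)     (yes (w≢0 , s)) = √#-nonzeroSquare w≢0 s
    classify (no w≢0)   (no ¬n)         = √#-nonsquare (λ s → ¬n (w≢0 , s))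

  -- The representatives listed in `PG1`. Statements about absent zeros must leave out (0, 0), where
  -- every form vanishes.
  data Normalised : Carrier → Carrier → Set c where
    affine : ∀ x → Normalised x 1#
    ∞      : Normalised 1# 0#

  #zeros-cong : ∀ {g : Carrier → Carrier → ℕ} {h} → (∀ {x y} → Normalised x y → 𝟙 (h x y ≟ 0#) ≡ g x y) →
    #zeros h ≡ ∑PG1 g
  #zeros-cong h≗g = cong₂ ℕ._+_ (∑F-cong λ x → h≗g (affine x)) (h≗g ∞)

  #zeros-none : ∀ {h} → (∀ {x y} → Normalised x y → h x y ≢ 0#) → #zeros h ≡ 0
  #zeros-none h≢0 = trans (#zeros-cong (𝟙-no _ ∘ h≢0)) (cong (ℕ._+ 0) (∑-zero elements))

  #zeros-+ : ∀ g h → ∑PG1 (λ x y → 𝟙 (g x y ≟ 0#) ℕ.+ 𝟙 (h x y ≟ 0#)) ≡ #zeros g ℕ.+ #zeros h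
  #zeros-+ g h = trans
    (cong (ℕ._+ (𝟙 (g 1# 0# ≟ 0#) ℕ.+ 𝟙 (h 1# 0# ≟ 0#))) (∑F-+ _ _))
    (interchange (∑F (λ x → 𝟙 (g x 1# ≟ 0#))) _ _ _)

  #zeros-* : ∀ {f} g h → (∀ x y → f x y ≡ g x y * h x y) →
    (∀ {x y} → Normalised x y → ¬ (g x y ≡ 0# × h x y ≡ 0#)) → #zeros f ≡ #zeros g ℕ.+ #zeros h
  #zeros-* {f} g h f≗gh disjoint = trans (#zeros-cong pointwise) (#zeros-+ g h)
    where
    pointwise : ∀ {x y} → Normalised x y → 𝟙 (f x y ≟ 0#) ≡ 𝟙 (g x y ≟ 0#) ℕ.+ 𝟙 (h x y ≟ 0#)
    pointwise {x} {y} p rewrite f≗gh x y with g x y ≟ 0# | h x y ≟ 0#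
    ... | yes g≡0 | yes h≡0 = contradiction (g≡0 , h≡0) (disjoint p)
    ... | yes g≡0 | no _    = 𝟙-yes _ (trans (cong (_* h x y) g≡0) (zeroˡ _))
    ... | no _    | yes h≡0 = 𝟙-yes _ (trans (cong (g x y *_) h≡0) (zeroʳ _))
    ... | no g≢0  | no h≢0  = 𝟙-no _ (*-≢0 g≢0 h≢0)

  evalLin : Lin F → Carrier → Carrier → Carrier
  evalLin (lin a b) x y = a * x + b * y

  evalQuad : Quad F → Carrier → Carrier → Carrier
  evalQuad (quad a b c) x y = a * (x * x) + b * (x * y) + c * (y * y)

  evalCub : Cub F → Carrier → Carrier → Carrier
  evalCub (cub a b c d) x y = a * (x * x * x) + b * (x * x * y) + c * (x * y * y) + d * (y * y * y)

  evalLinₚ : ∀ {m} (a b x y : Polynomial m) → Polynomial m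
  evalLinₚ a b x y = a :* x :+ b :* y

  evalQuadₚ : ∀ {m} (a b c x y : Polynomial m) → Polynomial m
  evalQuadₚ a b c x y = a :* (x :* x) :+ b :* (x :* y) :+ c :* (y :* y)

  evalCubₚ : ∀ {m} (a b c d x y : Polynomial m) → Polynomial m
  evalCubₚ a b c d x y = a :* (x :* x :* x) :+ b :* (x :* x :* y) :+ c :* (x :* y :* y) :+ d :* (y :* y :* y)

  eval-linLin : ∀ L M x y → evalQuad (linLin F L M) x y ≡ evalLin L x y * evalLin M x y
  eval-linLin (lin a b) (lin c d) x y = solve 6 (λ a b c d x y →
    evalQuadₚ (a :* c) (a :* d :+ b :* c) (b :* d) x y := evalLinₚ a b x y :* evalLinₚ c d x y)
    refl a b c d x y

  eval-linCub : ∀ L C x y → eval F (linCub F L C) x y ≡ evalLin L x y * evalCub C x y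
  eval-linCub (lin a b) (cub c d e g) x y = solve 8 (λ a b c d e g x y →
    evalₚ (a :* c) (a :* d :+ b :* c) (a :* e :+ b :* d) (a :* g :+ b :* e) (b :* g) x y :=
    evalLinₚ a b x y :* evalCubₚ c d e g x y) refl a b c d e g x y

  eval-quadQuad : ∀ Q R x y → eval F (quadQuad F Q R) x y ≡ evalQuad Q x y * evalQuad R x y
  eval-quadQuad (quad a b c) (quad d e g) x y = solve 8 (λ a b c d e g x y →
    evalₚ (a :* d) (a :* e :+ b :* d) (a :* g :+ b :* e :+ c :* d) (b :* g :+ c :* e) (c :* g) x y :=
    evalQuadₚ a b c x y :* evalQuadₚ d e g x y) refl a b c d e g x y

  quartic-≡ : ∀ {a a′ b b′ c c′ d d′ e e′} → a ≡ a′ → b ≡ b′ → c ≡ c′ → d ≡ d′ → e ≡ e′ →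
    _≡_ {A = Quartic F} (quartic a b c d e) (quartic a′ b′ c′ d′ e′)
  quartic-≡ refl refl refl refl refl = refl

  quadQuad-comm : ∀ Q R → quadQuad F Q R ≡ quadQuad F R Q
  quadQuad-comm (quad a b c) (quad d e g) = quartic-≡ (*-comm a d)
    (solve 4 (λ a b d e → a :* e :+ b :* d := d :* b :+ e :* a) refl a b d e)
    (solve 6 (λ a b c d e g → a :* g :+ b :* e :+ c :* d := d :* c :+ e :* b :+ g :* a) refl a b c d e g)
    (solve 4 (λ b c e g → b :* g :+ c :* e := e :* c :+ g :* b) refl b c e g) (*-comm c g)

  quad-≡ : ∀ {a a′ b b′ c c′} → a ≡ a′ → b ≡ b′ → c ≡ c′ → _≡_ {A = Quad F} (quad a b c) (quad a′ b′ c′)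
  quad-≡ refl refl refl = refl

  cub-≡ : ∀ {a a′ b b′ c c′ d d′} → a ≡ a′ → b ≡ b′ → c ≡ c′ → d ≡ d′ →
    _≡_ {A = Cub F} (cub a b c d) (cub a′ b′ c′ d′)
  cub-≡ refl refl refl refl = refl

  remainder-≡0 : ∀ {u v w} → u - v ≡ - w → w ≡ 0# → u ≡ v
  remainder-≡0 u-v≡-w refl = x-y≡0⇒x≡y (trans u-v≡-w -0#≈0#)

  -- Synthetic division by X - xY.
  quotient-step : ∀ x p q → 1# * (x * p + q) + - x * p ≡ q
  quotient-step = solve 3 (λ x p q → con 1₃ :* (x :* p :+ q) :+ :- x :* p := q) refl

  -- Division by Y.
  Y-step : ∀ p q → 0# * p + 1# * q ≡ q
  Y-step p q = trans (cong₂ _+_ (zeroˡ p) (*-identityˡ q)) (+-identityˡ q)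

  -- A zero would split off X - xY, or Y when it lies at infinity. Horner's scheme gives the
  -- quotient, and the remainder is the value at x. The cubic and quartic cases follow the same
  -- pattern.
  IrredQuad⇒≢0 : ∀ {Q} → IrredQuad F Q → ∀ {x y} → Normalised x y → evalQuad Q x y ≢ 0#
  IrredQuad⇒≢0 {quad a b c} irr (affine x) eq = irr (lin 1# (- x) , lin a p ,
    quad-≡ (*-identityˡ a) (quotient-step x a b)
      (remainder-≡0 (solve 4 (λ a b c x → :- x :* (x :* a :+ b) :- c := :- evalQuadₚ a b c x (con 1₃))
        refl a b c x) eq))
    where
    p = x * a + b
  IrredQuad⇒≢0 {quad a b c} irr ∞ eq = irr (lin 0# 1# , lin b c ,
    quad-≡ (trans (zeroˡ b) (sym a≡0)) (Y-step c b) (*-identityˡ c))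
    where
    a≡0 : a ≡ 0#
    a≡0 = trans (solve 3 (λ a b c → a := evalQuadₚ a b c (con 1₃) (con 0₃)) refl a b c) eq

  IrredCub⇒≢0 : ∀ {C} → IrredCub F C → ∀ {x y} → Normalised x y → evalCub C x y ≢ 0#
  IrredCub⇒≢0 {cub a b c d} irr (affine x) eq = irr (lin 1# (- x) , quad a p q ,
    cub-≡ (*-identityˡ a) (quotient-step x a b) (quotient-step x p c)
      (remainder-≡0 (solve 5 (λ a b c d x →
        :- x :* (x :* (x :* a :+ b) :+ c) :- d := :- evalCubₚ a b c d x (con 1₃)) refl a b c d x) eq))
    where
    p = x * a + b
    q = x * p + c
  IrredCub⇒≢0 {cub a b c d} irr ∞ eq = irr (lin 0# 1# , quad b c d ,
    cub-≡ (trans (zeroˡ b) (sym a≡0)) (Y-step c b) (Y-step d c) (*-identityˡ d))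
    where
    a≡0 : a ≡ 0#
    a≡0 = trans (solve 4 (λ a b c d → a := evalCubₚ a b c d (con 1₃) (con 0₃)) refl a b c d) eq

  IrredQuartic⇒≢0 : ∀ {f} → IrredQuartic F f → ∀ {x y} → Normalised x y → eval F f x y ≢ 0#
  IrredQuartic⇒≢0 {quartic a b c d e} (irr , _) (affine x) eq = irr (lin 1# (- x) , cub a p q r ,
    quartic-≡ (*-identityˡ a) (quotient-step x a b) (quotient-step x p c) (quotient-step x q d)
      (remainder-≡0 (solve 6 (λ a b c d e x →
        :- x :* (x :* (x :* (x :* a :+ b) :+ c) :+ d) :- e := :- evalₚ a b c d e x (con 1₃))
        refl a b c d e x) eq))
    where
    p = x * a + b
    q = x * p + c
    r = x * q + d
  IrredQuartic⇒≢0 {f@(quartic a b c d e)} (irr , _) ∞ eq = irr (lin 0# 1# , cub b c d e ,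
    quartic-≡ (trans (zeroˡ b) (trans (sym eq) (eval-∞ f)))
      (Y-step c b) (Y-step d c) (Y-step e d) (*-identityˡ e))

  NonzeroLin : Lin F → Set c
  NonzeroLin (lin a b) = ¬ (a ≡ 0# × b ≡ 0#)

  #zeros-lin : ∀ L → NonzeroLin L → #zeros (evalLin L) ≡ 1
  #zeros-lin (lin a b) nz with a ≟ 0#
  ... | no a≢0 = cong₂ ℕ._+_ (linear-roots a≢0 (b * 1#))
    (𝟙-no _ λ eq → a≢0 (trans (solve 2 (λ a b → a := evalLinₚ a b (con 1₃) (con 0₃)) refl a b) eq))
  ... | yes refl = cong₂ ℕ._+_
    (trans (∑F-cong λ x → 𝟙-no _ λ eq → nz (refl ,
      trans (solve 2 (λ b x → b := evalLinₚ (con 0₃) b x (con 1₃)) refl b x) eq)) (∑-zero elements))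
    (𝟙-yes _ (solve 1 (λ b → evalLinₚ (con 0₃) b (con 1₃) (con 0₃) := con 0₃) refl b))

  -- `Lin` admits the zero form, which has every point as a zero; it is excluded because it would
  -- make f vanish, against z2 = 1.
  linCub-nonzero : ∀ L C → z2 (linCub F L C) ≡ 1# → NonzeroLin L
  linCub-nonzero (lin a b) (cub _ d e _) z2≡1 (refl , refl) =
    0≢1 (trans (solve 2 (λ d e → con 0₃ := con 0₃ :* e :+ con 0₃ :* d) refl d e) z2≡1)

  linLinQuad-nonzero : ∀ L M Q → z2 (quadQuad F (linLin F L M) Q) ≡ 1# → NonzeroLin L × NonzeroLin M
  linLinQuad-nonzero (lin a b) (lin d e) (quad p q r) z2≡1 =
      (λ { (refl , refl) → 0≢1 (trans (solve 5 (λ d e p q r → con 0₃ :=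
        con 0₃ :* d :* r :+ (con 0₃ :* e :+ con 0₃ :* d) :* q :+ con 0₃ :* e :* p) refl d e p q r) z2≡1) })
    , (λ { (refl , refl) → 0≢1 (trans (solve 5 (λ a b p q r → con 0₃ :=
        a :* con 0₃ :* r :+ (a :* con 0₃ :+ b :* con 0₃) :* q :+ b :* con 0₃ :* p) refl a b p q r) z2≡1) })

  -- Multiple zeros force Δ = 0

  -- The hypotheses say that Y² divides f, and every term of Δ contains z0 or z1.
  Δ-singular-∞ : ∀ f → z0 f ≡ 0# → z1 f ≡ 0# → Δ F f ≡ 0#
  Δ-singular-∞ (quartic _ _ c d e) refl refl =
    solve 3 (λ c d e → Δₚ (con 0₃) (con 0₃) c d e := con 0₃) refl c d e

  -- `z3 (shift x f)` is the derivative of f(X, 1) at x, so the hypotheses describe a double zero,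
  -- which is moved to infinity.
  Δ-singular : ∀ x f → eval F f x 1# ≡ 0# → z3 (shift x f) ≡ 0# → Δ F f ≡ 0#
  Δ-singular x f f≡0 f′≡0 = trans (sym (Δ-to-∞ x f))
    (Δ-singular-∞ (to-∞ x f) (trans (z0-to-∞ x f) f≡0) f′≡0)

  zero-combination : ∀ {u v} p q → u ≡ 0# → v ≡ 0# → p * u + q * v ≡ 0#
  zero-combination p q refl refl = trans (cong₂ _+_ (zeroʳ p) (zeroʳ q)) (+-identityˡ 0#)

  Δ-common-zero : ∀ Q R {x y} → Normalised x y → evalQuad Q x y ≡ 0# → evalQuad R x y ≡ 0# →
    Δ F (quadQuad F Q R) ≡ 0#
  Δ-common-zero Q@(quad a b c) R@(quad d e g) (affine x) Q≡0 R≡0 = Δ-singular x (quadQuad F Q R)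
    (trans (eval-quadQuad Q R x 1#) (trans (cong (_* evalQuad R x 1#) Q≡0) (zeroˡ _)))
    -- The product rule (QR)' = R'Q + Q'R, where Q' = b + 2a x = b - a x.
    (trans (solve 7 (λ a b c d e g x →
        b :* g :+ c :* e :- x :* (a :* g :+ b :* e :+ c :* d) :+ x :^ 3 :* (a :* d) :=
        (e :- d :* x) :* evalQuadₚ a b c x (con 1₃) :+ (b :- a :* x) :* evalQuadₚ d e g x (con 1₃))
        refl a b c d e g x)
      (zero-combination (e - d * x) (b - a * x) Q≡0 R≡0))
  Δ-common-zero Q@(quad a b c) R@(quad d e g) ∞ Q≡0 R≡0 = Δ-singular-∞ (quadQuad F Q R)
    (trans (cong (_* d) a≡0) (zeroˡ d))
    (trans (solve 4 (λ a b d e → a :* e :+ b :* d := e :* a :+ b :* d) refl a b d e)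
      (zero-combination e b a≡0 d≡0))
    where
    leading : ∀ a b c → a ≡ evalQuad (quad a b c) 1# 0#
    leading = solve 3 (λ a b c → a := evalQuadₚ a b c (con 1₃) (con 0₃)) refl
    a≡0 = trans (leading a b c) Q≡0
    d≡0 = trans (leading d e g) R≡0

  Δ-repeated-zero : ∀ L M Q {x y} → Normalised x y → evalLin L x y ≡ 0# → evalLin M x y ≡ 0# →
    Δ F (quadQuad F (linLin F L M) Q) ≡ 0#
  Δ-repeated-zero L@(lin a b) M@(lin d e) Q@(quad p q r) (affine x) L≡0 M≡0 =
    Δ-singular x (quadQuad F (linLin F L M) Q)
    (trans (eval-quadQuad (linLin F L M) Q x 1#) (trans (cong (_* evalQuad Q x 1#)
      (trans (eval-linLin L M x 1#) (trans (cong (_* evalLin M x 1#) L≡0) (zeroˡ _)))) (zeroˡ _)))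
    -- The product rule for LMQ, grouped as a multiple of L plus a multiple of M.
    (trans (solve 8 (λ a b d e p q r x →
        (a :* e :+ b :* d) :* r :+ b :* e :* q
          :- x :* (a :* d :* r :+ (a :* e :+ b :* d) :* q :+ b :* e :* p) :+ x :^ 3 :* (a :* d :* p) :=
        (d :* evalQuadₚ p q r x (con 1₃) :+ evalLinₚ d e x (con 1₃) :* (q :- p :* x))
          :* evalLinₚ a b x (con 1₃)
          :+ (a :* evalQuadₚ p q r x (con 1₃)) :* evalLinₚ d e x (con 1₃)) refl a b d e p q r x)
      (zero-combination _ _ L≡0 M≡0))
  Δ-repeated-zero L@(lin a b) M@(lin d e) Q@(quad p q r) ∞ L≡0 M≡0 =
    Δ-singular-∞ (quadQuad F (linLin F L M) Q)
    (trans (solve 3 (λ a d p → a :* d :* p := (d :* p) :* a :+ con 0₃ :* d) refl a d p)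
      (zero-combination (d * p) 0# a≡0 d≡0))
    (trans (solve 6 (λ a b d e p q → a :* d :* q :+ (a :* e :+ b :* d) :* p :=
        (d :* q :+ e :* p) :* a :+ (b :* p) :* d)
        refl a b d e p q)
      (zero-combination (d * q + e * p) (b * p) a≡0 d≡0))
    where
    leading : ∀ a b → a ≡ evalLin (lin a b) 1# 0#
    leading = solve 2 (λ a b → a := evalLinₚ a b (con 1₃) (con 0₃)) refl
    a≡0 = trans (leading a b) L≡0
    d≡0 = trans (leading d e) M≡0

  -- Numbers of zeros by factorization type

  #zeros-linLin : ∀ L M Q → Δ F (quadQuad F (linLin F L M) Q) ≢ 0# →
    z2 (quadQuad F (linLin F L M) Q) ≡ 1# →
    #zeros (evalQuad (linLin F L M)) ≡ 2
  #zeros-linLin L M Q Δ≢0 z2≡1 with linLinQuad-nonzero L M Q z2≡1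
  ... | L≢0 , M≢0 = trans
    (#zeros-* (evalLin L) (evalLin M) (eval-linLin L M)
      (λ p (L≡0 , M≡0) → Δ≢0 (Δ-repeated-zero L M Q p L≡0 M≡0)))
    (cong₂ ℕ._+_ (#zeros-lin L L≢0) (#zeros-lin M M≢0))

  #zeros-quadQuad : ∀ Q R → Δ F (quadQuad F Q R) ≢ 0# →
    #zeros (eval F (quadQuad F Q R)) ≡ #zeros (evalQuad Q) ℕ.+ #zeros (evalQuad R)
  #zeros-quadQuad Q R Δ≢0 = #zeros-* (evalQuad Q) (evalQuad R) (eval-quadQuad Q R)
    (λ p (Q≡0 , R≡0) → Δ≢0 (Δ-common-zero Q R p Q≡0 R≡0))

  #zeros-irredQuad : ∀ {Q} → IrredQuad F Q → #zeros (evalQuad Q) ≡ 0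
  #zeros-irredQuad irr = #zeros-none (IrredQuad⇒≢0 irr)

  #zeros-F1 : ∀ f → z2 f ≡ 1# → IsF1 F f → #zeros (eval F f) ≡ 1
  #zeros-F1 _ z2≡1 (L , C , irr , refl) = trans
    (#zeros-* (evalLin L) (evalCub C) (eval-linCub L C) (λ p (_ , C≡0) → IrredCub⇒≢0 irr p C≡0))
    (cong₂ ℕ._+_ (#zeros-lin L (linCub-nonzero L C z2≡1)) (#zeros-none (IrredCub⇒≢0 irr)))

  #zeros-F2 : ∀ f → Δ F f ≢ 0# → z2 f ≡ 1# → IsF2 F f → #zeros (eval F f) ≡ 2
  #zeros-F2 _ Δ≢0 z2≡1 (L , M , Q , irr , refl) = trans (#zeros-quadQuad (linLin F L M) Q Δ≢0)
    (cong₂ ℕ._+_ (#zeros-linLin L M Q Δ≢0 z2≡1) (#zeros-irredQuad irr))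

  #zeros-F4 : ∀ f → Δ F f ≢ 0# → z2 f ≡ 1# → IsF4 F f → #zeros (eval F f) ≡ 4
  #zeros-F4 _ Δ≢0 z2≡1 (L₁ , L₂ , L₃ , L₄ , refl) = trans (#zeros-quadQuad Q R Δ≢0)
    (cong₂ ℕ._+_ (#zeros-linLin L₁ L₂ R Δ≢0 z2≡1)
      -- `#zeros-linLin` treats the first factor, so the product is commuted for the second pair.
      (#zeros-linLin L₃ L₄ Q (Δ≢0 ∘ trans (cong (Δ F) (quadQuad-comm Q R)))
        (trans (cong z2 (quadQuad-comm R Q)) z2≡1)))
    where
    Q = linLin F L₁ L₂
    R = linLin F L₃ L₄

  #zeros-F2′⊎F4′ : ∀ f → Δ F f ≢ 0# → IsF2' F f ⊎ IsF4' F f → #zeros (eval F f) ≡ 0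
  #zeros-F2′⊎F4′ f Δ≢0 (inj₁ irr) = #zeros-none (IrredQuartic⇒≢0 irr)
  #zeros-F2′⊎F4′ _ Δ≢0 (inj₂ (Q , R , irrQ , irrR , refl)) =
    trans (#zeros-quadQuad Q R Δ≢0) (cong₂ ℕ._+_ (#zeros-irredQuad irrQ) (#zeros-irredQuad irrR))

open import Data.Nat using (_+_; _*_)

theorem5p1 : ∀ {c : Level} (F : FiniteField c) → HasChar3 F →
  (f : Quartic F) →
  Δ F f ≢ FiniteField.0# F →
  ȷ F f ≢ FiniteField.0# F →
  z2 f ≡ FiniteField.1# F →
  (IsF1 F f → 2 * ζ F f + 1 ≡ #E F (ȷ F f))
  × (IsF2 F f → 2 * ζ F f + 2 ≡ #E F (ȷ F f))
  × (IsF4 F f → 2 * ζ F f + 4 ≡ #E F (ȷ F f))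
  × (IsF2' F f ⊎ IsF4' F f → 2 * ζ F f ≡ #E F (ȷ F f))
theorem5p1 F char3 f Δ≢0 ȷ≢0 z2≡1 =
    (λ f∈F1 → count-by (#zeros-F1 f z2≡1 f∈F1))
  , (λ f∈F2 → count-by (#zeros-F2 f Δ≢0 z2≡1 f∈F2))
  , (λ f∈F4 → count-by (#zeros-F4 f Δ≢0 z2≡1 f∈F4))
  , (λ f∈F2′⊎F4′ → trans (sym (ℕ.+-identityʳ _)) (count-by (#zeros-F2′⊎F4′ f Δ≢0 f∈F2′⊎F4′)))
  where
  open Char3 F char3
  count-by : ∀ {i} → #zeros (eval F f) ≡ i → 2 * ζ F f + i ≡ #E F (ȷ F f)
  count-by refl = trans (sym (#C≡2ζ+#zeros f)) (#C≡#E f Δ≢0 ȷ≢0 z2≡1)
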